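{- Let $M$ be a multi-path matroid and $F$ a proper flat of $M$ (a flat different from the whole ground set). Then the restriction $M|F$ is a lattice path matroid.
   Context: Transversal matroid $M[\mathcal{A}]$ of a multiset $\mathcal{A}$ of subsets of a finite set $S$: its independent sets are the partial transversals of $\mathcal{A}$. For a cyclic permutation $\sigma$ of $S$, a $\sigma$-interval is a nonempty set $\{f,\sigma(f),\ldots,l\}$. A multi-path matroid is a transversal matroid with a presentation by an antichain (no member containing another) of $\sigma$-intervals for some cyclic permutation $\sigma$ of its ground set. A lattice path matroid is a matroid isomorphic to $M[P,Q]$ for lattice paths $P,Q$ from $(0,0)$ to $(m,r)$ with $P$ never above $Q$, where $M[P,Q]$ is the transversal matroid on $[m+r]$ presented by $(N_1,\ldots,N_r)$, $N_i$ being the set of $j$ such that the $j$-th step of some lattice path from $(0,0)$ to $(m,r)$ staying weakly between $P$ and $Q$ is its $i$-th North step (equivalently, a transversal matroid with a presentation by an antichain of intervals in a linear order on its ground set). The empty matroid is regarded as a lattice path matroid. -}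

module Defs where

open import Data.Nat using (ℕ; zero; suc; _+_; _≤_)
open import Data.Fin using (Fin; toℕ) renaming (zero to fzero; suc to fsuc)
open import Data.Fin.Subset using (Subset; _∈_; _∉_; _⊆_; _∪_; ⁅_⁆; ∣_∣)
open import Data.Fin.Permutation using (Permutation′; _⟨$⟩ʳ_)
open import Data.Bool using (Bool; true; false; if_then_else_)
open import Data.Vec using (tabulate; lookup)
open import Data.Product using (Σ; ∃; ∃-syntax; _×_)
open import Relation.Binary.PropositionalEquality using (_≡_; _≢_)
open import Relation.Nullary using (¬_)
open import Function using (_∘_; _⇔_)

PartialTransversal : {n r : ℕ} → (Fin r → Fin n → Set) → Subset n → Set
PartialTransversal {n} {r} A X =
  Σ ((x : Fin n) → x ∈ X → Fin r) λ φ →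
    ((x : Fin n) (p : x ∈ X) → A (φ x p) x) ×
    ((x y : Fin n) (p : x ∈ X) (q : y ∈ X) → φ x p ≡ φ y q → x ≡ y)

memb : {n r : ℕ} → (Fin r → Subset n) → Fin r → Fin n → Set
memb A i x = x ∈ A i

-- Matroids on Fin n given by their independence predicate.
Indep : ℕ → Set₁
Indep n = Subset n → Set

IsRankOf : {n : ℕ} → Indep n → Subset n → ℕ → Set
IsRankOf I X k =
  (∃[ Y ] (Y ⊆ X × I Y × ∣ Y ∣ ≡ k)) ×
  (∀ Y → Y ⊆ X → I Y → ∣ Y ∣ ≤ k)

IsFlat : {n : ℕ} → Indep n → Subset n → Set
IsFlat I F = ∀ e → e ∉ F → ∀ k → IsRankOf I F k → ¬ IsRankOf I (F ∪ ⁅ e ⁆) k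

IsProperFlat : {n : ℕ} → Indep n → Subset n → Set
IsProperFlat I F = IsFlat I F × ∃[ e ] (e ∉ F)

iter : {n : ℕ} → Permutation′ n → ℕ → Fin n → Fin n
iter σ zero x = x
iter σ (suc k) x = σ ⟨$⟩ʳ (iter σ k x)

IsCyclic : {n : ℕ} → Permutation′ n → Set
IsCyclic {n} σ = ∀ (x y : Fin n) → ∃[ k ] (iter σ k x ≡ y)

IsσInterval : {n : ℕ} → Permutation′ n → Subset n → Set
IsσInterval {n} σ I = ∃[ f ] ∃[ k ] (∀ (x : Fin n) → (x ∈ I) ⇔ (∃[ j ] (j ≤ k × iter σ j f ≡ x)))

IsAntichain : {n r : ℕ} → (Fin r → Subset n) → Set
IsAntichain A = ∀ i j → i ≢ j → ¬ (A i ⊆ A j)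

-- Lattice paths: a path with k steps is Fin k → Bool, true = North, false = East.

northUpTo : {k : ℕ} → (Fin k → Bool) → ℕ → ℕ
northUpTo {zero} p j = 0
northUpTo {suc k} p zero = 0
northUpTo {suc k} p (suc j) = (if p fzero then 1 else 0) + northUpTo (p ∘ fsuc) j

IsLatticePath : (m r : ℕ) → (Fin (m + r) → Bool) → Set
IsLatticePath m r p = northUpTo p (m + r) ≡ r

NeverAbove : {k : ℕ} → (Fin k → Bool) → (Fin k → Bool) → Set
NeverAbove P Q = ∀ j → northUpTo P j ≤ northUpTo Q j

-- N_i (0-indexed i): the j such that the j-th step of some lattice path R between P and Q
-- is its i-th North step.
NSet : (m r : ℕ) → (P Q : Fin (m + r) → Bool) → Fin r → Fin (m + r) → Set
NSet m r P Q i j =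
  Σ (Fin (m + r) → Bool) λ R → (IsLatticePath m r R × NeverAbove P R × NeverAbove R Q ×
          R j ≡ true × northUpTo R (toℕ j) ≡ toℕ i)

LPMIndep : (m r : ℕ) → (P Q : Fin (m + r) → Bool) → Indep (m + r)
LPMIndep m r P Q = PartialTransversal (NSet m r P Q)

-- The restriction M|F (M given by independence I on Fin n) is isomorphic to M[P,Q]
-- for lattice paths P ≤ Q from (0,0) to (m,r): there is an injection g : Fin (m+r) → Fin n
-- with image exactly F such that X ⊆ F is independent in M iff g⁻¹(X) is in M[P,Q].
-- (m = r = 0 covers the empty matroid.)
RestrictionIsLPM : {n : ℕ} → Indep n → Subset n → Set
RestrictionIsLPM {n} I F =
  Σ ℕ λ m → Σ ℕ λ r → Σ (Fin (m + r) → Bool) λ P → Σ (Fin (m + r) → Bool) λ Q →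
    (IsLatticePath m r P × IsLatticePath m r Q × NeverAbove P Q ×
     Σ (Fin (m + r) → Fin n) λ g → ((∀ (a b : Fin (m + r)) → g a ≡ g b → a ≡ b) ×
             (∀ (x : Fin n) → (x ∈ F) ⇔ (∃[ a ] (g a ≡ x))) ×
             (∀ (X : Subset n) → X ⊆ F →
                (I X ⇔ LPMIndep m r P Q (tabulate (λ a → lookup X (g a)))))))

{-# OPTIONS --safe #-}

-- Since F is a proper flat, its rank is smaller than the number of sets, so a maximum matching of F leaves some set
-- A j₀ unused. Exchanging matchings (Mendelsohn–Dulmage) shows that every element of F ∩ A j₀ is a coloop of M|F.
-- Outside A j₀ nothing wraps around any more: by the antichain condition A j ∖ A j₀ is an interval of the linear order
-- that starts at the first element of A j₀, and the endpoints of these traces increase weakly with j. Together with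
-- singletons for the coloops they present M|F. For such a monotone family fix the index set J of a maximum matching:
-- a set R with |R| = |J| is a basis iff each prefix [0,b) contains at most as many elements of R as there are j ∈ J
-- whose set has started before b, and at least as many as there are j ∈ J whose set is finished before b. The highest
-- and the lowest path within these bounds are Q and P.
module Submission where

open import Defs
open import Data.Nat using (ℕ; zero; suc; _+_; _∸_; _≤_; _<_; _≤?_; _<?_; _⊔_; _⊓_; pred; z≤n; s≤s)
open import Data.Nat.Properties as ℕ using (≤-refl; ≤-trans; <-≤-trans; ≤-<-trans; <-trans; ≤-antisym; <-irrefl; <⇒≤; <⇒≱; ≤⇒≯; ≮⇒≥; ≰⇒>; ≤-reflexive; <-cmp; n≤1+n)
open import Data.Fin as Fin using (Fin; toℕ; fromℕ<) renaming (zero to fzero; suc to fsuc)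
open import Data.Fin.Properties using (toℕ<n; toℕ-injective; toℕ-fromℕ<; any?; all?; ¬∀⟶∃¬; injective⇒≤; pigeonhole)
open import Data.Bool using (Bool; true; false; if_then_else_)
import Data.Bool.Properties as Bool
open import Data.Maybe using (Maybe; just; nothing; is-just)
open import Data.Maybe.Properties using (just-injective; ≡-dec)
open import Data.Vec using (Vec; []; _∷_; lookup; tabulate)
open import Data.Vec.Properties using (lookup∘tabulate; []=⇒lookup; lookup⇒[]=)
open import Data.Fin.Subset using (Subset; _∈_; _∉_; _⊆_; _∪_; ⁅_⁆; ∣_∣)
open import Data.Fin.Subset.Properties using (_∈?_; p⊆p∪q)
open import Data.Fin.Permutation using (Permutation′; _⟨$⟩ʳ_; _⟨$⟩ˡ_; inverseˡ)
open import Data.Product using (Σ; ∃; ∃-syntax; _×_; _,_; proj₁; proj₂)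
open import Data.Sum using (_⊎_; inj₁; inj₂)
open import Data.Empty using (⊥-elim)
open import Relation.Binary.PropositionalEquality using (_≡_; _≢_; refl; sym; trans; cong; subst; subst₂; module ≡-Reasoning)
open import Relation.Binary.Definitions using (tri<; tri≈; tri>)
open import Relation.Nullary using (¬_; Dec; yes; no; does; contradiction)
open import Relation.Nullary.Decidable using (map′; dec-true; dec-false; decidable-stable; ¬?; _×-dec_; _⊎-dec_; _→-dec_)
open import Relation.Unary using (Decidable)
open import Function using (_∘_; _⇔_; mk⇔; Equivalence)

-- Prefix counts

does-sound : {P : Set} (P? : Dec P) → does P? ≡ true → P
does-sound (yes p) _ = p

bit : Bool → ℕ
bit b = if b then 1 else 0

northUpTo-zero : {n : ℕ} (p : Fin n → Bool) → northUpTo p 0 ≡ 0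
northUpTo-zero {zero}  p = refl
northUpTo-zero {suc n} p = refl

northUpTo-step : {n : ℕ} (p : Fin n → Bool) (x : Fin n) →
  northUpTo p (suc (toℕ x)) ≡ northUpTo p (toℕ x) + bit (p x)
northUpTo-step p fzero = trans (cong (bit (p fzero) +_) (northUpTo-zero (p ∘ fsuc))) (ℕ.+-comm (bit (p fzero)) 0)
northUpTo-step p (fsuc x) = trans (cong (bit (p fzero) +_) (northUpTo-step (p ∘ fsuc) x))
  (sym (ℕ.+-assoc (bit (p fzero)) (northUpTo (p ∘ fsuc) (toℕ x)) (bit (p (fsuc x)))))

northUpTo-north : {n : ℕ} (p : Fin n → Bool) (x : Fin n) → p x ≡ true →
  northUpTo p (suc (toℕ x)) ≡ suc (northUpTo p (toℕ x))
northUpTo-north p x px = trans (northUpTo-step p x)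
  (trans (cong (λ b → northUpTo p (toℕ x) + bit b) px) (ℕ.+-comm (northUpTo p (toℕ x)) 1))

northUpTo-mono : {n : ℕ} (p : Fin n → Bool) {a b : ℕ} → a ≤ b → northUpTo p a ≤ northUpTo p b
northUpTo-mono {zero}  p a≤b = z≤n
northUpTo-mono {suc n} p z≤n = z≤n
northUpTo-mono {suc n} p (s≤s a≤b) = ℕ.+-monoʳ-≤ (bit (p fzero)) (northUpTo-mono (p ∘ fsuc) a≤b)

northUpTo-saturated : {n : ℕ} (p : Fin n → Bool) {b : ℕ} → n ≤ b → northUpTo p b ≡ northUpTo p n
northUpTo-saturated {zero}  p n≤b = refl
northUpTo-saturated {suc n} p (s≤s n≤b) = cong (bit (p fzero) +_) (northUpTo-saturated (p ∘ fsuc) n≤b)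

northUpTo-≤ : {n : ℕ} (p : Fin n → Bool) (b : ℕ) → northUpTo p b ≤ b
northUpTo-≤ {zero}  p b = z≤n
northUpTo-≤ {suc n} p zero = z≤n
northUpTo-≤ {suc n} p (suc b) with p fzero
... | true  = s≤s (northUpTo-≤ (p ∘ fsuc) b)
... | false = ≤-trans (northUpTo-≤ (p ∘ fsuc) b) (n≤1+n b)

northUpTo-all : {n : ℕ} {b : ℕ} → b ≤ n → northUpTo {n} (λ _ → true) b ≡ b
northUpTo-all {zero}  z≤n = refl
northUpTo-all {suc n} z≤n = refl
northUpTo-all {suc n} (s≤s b≤n) = cong suc (northUpTo-all b≤n)

northUpTo-< : {n : ℕ} (p : Fin n → Bool) (x : Fin n) {b : ℕ} → p x ≡ true → toℕ x < b →
  northUpTo p (toℕ x) < northUpTo p b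
northUpTo-< p x px x<b = ≤-trans (≤-reflexive (sym (northUpTo-north p x px))) (northUpTo-mono p x<b)

northUpTo-injective : {n : ℕ} (p : Fin n → Bool) (x y : Fin n) → p x ≡ true → p y ≡ true →
  northUpTo p (toℕ x) ≡ northUpTo p (toℕ y) → x ≡ y
northUpTo-injective p x y px py eq with <-cmp (toℕ x) (toℕ y)
... | tri< x<y _ _ = contradiction (northUpTo-< p x px x<y) (<-irrefl eq)
... | tri≈ _ x≡y _ = toℕ-injective x≡y
... | tri> _ _ y<x = contradiction (northUpTo-< p y py y<x) (<-irrefl (sym eq))

-- Inverse to the prefix count on true positions: it numbers them from zero in increasing order,
-- which turns counting arguments into maps between `Fin` types.
select : {n : ℕ} (p : Fin n → Bool) (b : ℕ) {c : ℕ} → c < northUpTo p b →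
  ∃[ x ] (toℕ x < b × p x ≡ true × northUpTo p (toℕ x) ≡ c)
select {suc n} p (suc b) {c} c< with p fzero in p0
select {suc n} p (suc b) {zero} c< | true = fzero , s≤s z≤n , p0 , refl
select {suc n} p (suc b) {suc c} (s≤s c<) | true =
  let x , x<b , px , eq = select (p ∘ fsuc) b c<
  in fsuc x , s≤s x<b , px , trans (cong (λ t → bit t + northUpTo (p ∘ fsuc) (toℕ x)) p0) (cong suc eq)
select {suc n} p (suc b) {c} c< | false =
  let x , x<b , px , eq = select (p ∘ fsuc) b c<
  in fsuc x , s≤s x<b , px , trans (cong (λ t → bit t + northUpTo (p ∘ fsuc) (toℕ x)) p0) eq

-- `select` numbers the sources, and the prefix count of the chosen partner numbers the targets. A
-- relation `_~_` in place of a function lets a partial matching be read in both directions.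
northUpTo-pigeonhole : {n m : ℕ} (p : Fin n → Bool) (q : Fin m → Bool) (b c : ℕ)
  (_~_ : Fin n → Fin m → Set) →
  (∀ x → toℕ x < b → p x ≡ true → ∃[ y ] (toℕ y < c × q y ≡ true × x ~ y)) →
  (∀ {x x′ y} → x ~ y → x′ ~ y → x ≡ x′) →
  northUpTo p b ≤ northUpTo q c
northUpTo-pigeonhole {n} {m} p q b c _~_ assign ~-injective = injective⇒≤ {f = f} f-injective
  where
  source : (t : Fin (northUpTo p b)) → ∃[ x ] (toℕ x < b × p x ≡ true × northUpTo p (toℕ x) ≡ toℕ t)
  source t = select p b (toℕ<n t)

  target : (t : Fin (northUpTo p b)) → ∃[ y ] (toℕ y < c × q y ≡ true × proj₁ (source t) ~ y)
  target t = let x , x<b , px , _ = source t in assign x x<b px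

  f : Fin (northUpTo p b) → Fin (northUpTo q c)
  f t = let y , y<c , qy , _ = target t in fromℕ< (northUpTo-< q y qy y<c)

  f-injective : ∀ {s t} → f s ≡ f t → s ≡ t
  f-injective {s} {t} fs≡ft =
    let x , _ , _ , x≡s = source s
        x′ , _ , _ , x′≡t = source t
        y , y<c , qy , x~y = target s
        y′ , y′<c , qy′ , x′~y′ = target t
        y≡y′ = northUpTo-injective q y y′ qy qy′
          (trans (sym (toℕ-fromℕ< (northUpTo-< q y qy y<c)))
            (trans (cong toℕ fs≡ft) (toℕ-fromℕ< (northUpTo-< q y′ qy′ y′<c))))
        x≡x′ = ~-injective x~y (subst (x′ ~_) (sym y≡y′) x′~y′)
    in toℕ-injective (trans (sym x≡s) (trans (cong (northUpTo p ∘ toℕ) x≡x′) x′≡t))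

-- If no such position existed, the identity would embed the larger set into the smaller one.
northUpTo-excess : {n : ℕ} (p q : Fin n → Bool) (b c : ℕ) → northUpTo q c < northUpTo p b →
  ∃[ x ] (toℕ x < b × p x ≡ true × ¬ (toℕ x < c × q x ≡ true))
northUpTo-excess p q b c q<p with any? (λ x → toℕ x <? b ×-dec p x Bool.≟ true ×-dec ¬? (toℕ x <? c ×-dec q x Bool.≟ true))
... | yes found = found
... | no none = contradiction (northUpTo-pigeonhole p q b c _≡_ keep (λ x≡y x′≡y → trans x≡y (sym x′≡y))) (<⇒≱ q<p)
  where
  keep : ∀ x → toℕ x < b → p x ≡ true → ∃[ y ] (toℕ y < c × q y ≡ true × x ≡ y)
  keep x x<b px =
    let x<c , qx = decidable-stable (toℕ x <? c ×-dec q x Bool.≟ true) (λ out → none (x , x<b , px , out))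
    in x , x<c , qx , refl

northUpTo-⊆ : {n : ℕ} (p q : Fin n → Bool) → (∀ x → p x ≡ true → q x ≡ true) → northUpTo p n ≤ northUpTo q n
northUpTo-⊆ {n} p q p⊆q = northUpTo-pigeonhole p q n n _≡_
  (λ x x<n px → x , x<n , p⊆q x px , refl) (λ x≡y x′≡y → trans x≡y (sym x′≡y))

northUpTo-strict : {n : ℕ} (p q : Fin n → Bool) → (∀ x → p x ≡ true → q x ≡ true) →
  (x : Fin n) → p x ≡ false → q x ≡ true → northUpTo p n < northUpTo q n
northUpTo-strict {suc n} p q p⊆q fzero p0 q0 rewrite p0 | q0 = s≤s (northUpTo-⊆ (p ∘ fsuc) (q ∘ fsuc) (p⊆q ∘ fsuc))
northUpTo-strict {suc n} p q p⊆q (fsuc x) px qx = ℕ.+-mono-≤-< (bit-mono (p⊆q fzero))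
  (northUpTo-strict (p ∘ fsuc) (q ∘ fsuc) (p⊆q ∘ fsuc) x px qx)
  where
  bit-mono : {s t : Bool} → (s ≡ true → t ≡ true) → bit s ≤ bit t
  bit-mono {false} {t} s⇒t = z≤n
  bit-mono {true} {t} s⇒t rewrite s⇒t refl = ≤-refl

∣-∣-northUpTo : {n : ℕ} (X : Subset n) → ∣ X ∣ ≡ northUpTo (lookup X) n
∣-∣-northUpTo [] = refl
∣-∣-northUpTo (true ∷ X) = cong suc (∣-∣-northUpTo X)
∣-∣-northUpTo (false ∷ X) = ∣-∣-northUpTo X

-- Matchings as partial functions

Dom : {n r : ℕ} → (Fin n → Maybe (Fin r)) → Fin n → Set
Dom φ x = ∃[ i ] (φ x ≡ just i)

Im : {n r : ℕ} → (Fin n → Maybe (Fin r)) → Fin r → Set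
Im φ i = ∃[ x ] (φ x ≡ just i)

Matches : {n r : ℕ} → (Fin r → Fin n → Set) → (Fin n → Maybe (Fin r)) → Set
Matches B φ = (∀ x i → φ x ≡ just i → B i x) × (∀ x y i → φ x ≡ just i → φ y ≡ just i → x ≡ y)

-- The domain may exceed `X`: a matching can then be enlarged while still witnessing the
-- independence of `X`.
Covers : {n r : ℕ} → (Fin r → Fin n → Set) → Subset n → Set
Covers B X = ∃[ φ ] (Matches B φ × (∀ x → x ∈ X → Dom φ x))

_≟ᴹ_ : {r : ℕ} (s t : Maybe (Fin r)) → Dec (s ≡ t)
_≟ᴹ_ = ≡-dec Fin._≟_

im? : {n r : ℕ} (φ : Fin n → Maybe (Fin r)) (i : Fin r) → Dec (Im φ i)
im? φ i = any? (λ x → φ x ≟ᴹ just i)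

dom : {n r : ℕ} → (Fin n → Maybe (Fin r)) → Fin n → Bool
dom φ x = is-just (φ x)

dom-sound : {n r : ℕ} (φ : Fin n → Maybe (Fin r)) {x : Fin n} → dom φ x ≡ true → Dom φ x
dom-sound φ {x} d with φ x
... | just i = i , refl

dom-complete : {n r : ℕ} (φ : Fin n → Maybe (Fin r)) {x : Fin n} → Dom φ x → dom φ x ≡ true
dom-complete φ (i , eq) = cong is-just eq

transversal⇒covers : {n r : ℕ} {B : Fin r → Fin n → Set} (X : Subset n) → PartialTransversal B X → Covers B X
transversal⇒covers {n} {r} {B} X (ψ , ψ∈B , ψ-injective) = φ , (φ∈B , φ-injective) , covered
  where
  choose : (x : Fin n) → Dec (x ∈ X) → Maybe (Fin r)
  choose x (yes x∈X) = just (ψ x x∈X)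
  choose x (no _) = nothing

  φ : Fin n → Maybe (Fin r)
  φ x = choose x (x ∈? X)

  defined : ∀ x i → φ x ≡ just i → Σ (x ∈ X) (λ x∈X → ψ x x∈X ≡ i)
  defined x i eq with x ∈? X
  ... | yes x∈X = x∈X , just-injective eq

  φ∈B : ∀ x i → φ x ≡ just i → B i x
  φ∈B x i eq = let x∈X , ψx≡i = defined x i eq in subst (λ j → B j x) ψx≡i (ψ∈B x x∈X)

  φ-injective : ∀ x y i → φ x ≡ just i → φ y ≡ just i → x ≡ y
  φ-injective x y i eqx eqy =
    let x∈X , ψx≡i = defined x i eqx
        y∈X , ψy≡i = defined y i eqy
    in ψ-injective x y x∈X y∈X (trans ψx≡i (sym ψy≡i))

  covered : ∀ x → x ∈ X → Dom φ x
  covered x x∈X with x ∈? X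
  ... | yes p = ψ x p , refl
  ... | no x∉X = contradiction x∈X x∉X

covers⇒transversal : {n r : ℕ} {B : Fin r → Fin n → Set} (X : Subset n) → Covers B X → PartialTransversal B X
covers⇒transversal X (φ , (φ∈B , φ-injective) , covered) =
  (λ x x∈X → proj₁ (covered x x∈X)) ,
  (λ x x∈X → φ∈B x _ (proj₂ (covered x x∈X))) ,
  (λ x y x∈X y∈X eq → φ-injective x y _ (proj₂ (covered x x∈X)) (trans (proj₂ (covered y y∈X)) (cong just (sym eq))))

-- An earlier value at `x` is overwritten, so the domain never shrinks, although the old index of
-- `x` may become free.
assign : {n r : ℕ} → (Fin n → Maybe (Fin r)) → Fin n → Fin r → Fin n → Maybe (Fin r)
assign φ x i y with y Fin.≟ x
... | yes _ = just i
... | no _ = φ y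

assign-here : {n r : ℕ} (φ : Fin n → Maybe (Fin r)) (x : Fin n) (i : Fin r) → assign φ x i x ≡ just i
assign-here φ x i with x Fin.≟ x
... | yes _ = refl
... | no x≢x = contradiction refl x≢x

assign-there : {n r : ℕ} (φ : Fin n → Maybe (Fin r)) (x : Fin n) (i : Fin r) {y : Fin n} → y ≢ x → assign φ x i y ≡ φ y
assign-there φ x i {y} y≢x with y Fin.≟ x
... | yes y≡x = contradiction y≡x y≢x
... | no _ = refl

assign-Dom : {n r : ℕ} (φ : Fin n → Maybe (Fin r)) (x : Fin n) (i : Fin r) {y : Fin n} → Dom φ y → Dom (assign φ x i) y
assign-Dom φ x i {y} d with y Fin.≟ x
... | yes _ = i , refl
... | no _ = d

assign-matches : {n r : ℕ} {B : Fin r → Fin n → Set} {φ : Fin n → Maybe (Fin r)} {x : Fin n} {i : Fin r} →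
  Matches B φ → B i x → ¬ Im φ i → Matches B (assign φ x i)
assign-matches {B = B} {φ} {x} {i} (φ∈B , φ-injective) Bix i∉Im = sound , injective
  where
  sound : ∀ y j → assign φ x i y ≡ just j → B j y
  sound y j eq with y Fin.≟ x
  sound y j refl | yes refl = Bix
  sound y j eq | no _ = φ∈B y j eq

  injective : ∀ y z j → assign φ x i y ≡ just j → assign φ x i z ≡ just j → y ≡ z
  injective y z j eqy eqz with y Fin.≟ x | z Fin.≟ x
  ... | yes y≡x | yes z≡x = trans y≡x (sym z≡x)
  ... | no _ | no _ = φ-injective y z j eqy eqz
  injective y z j refl eqz | yes _ | no _ = contradiction (z , eqz) i∉Im
  injective y z j eqy refl | no _ | yes _ = contradiction (y , eqy) i∉Im

-- Giving an unused index of φ₀ back to its φ₀-partner keeps the domain of φ and creates a new agreement with φ₀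
-- without destroying an old one, so the reassignment process terminates.
mendelsohn-dulmage : {n r : ℕ} {B : Fin r → Fin n → Set} {φ₀ φ : Fin n → Maybe (Fin r)} →
  Matches B φ₀ → Matches B φ →
  ∃[ φ′ ] (Matches B φ′ × (∀ x → Dom φ x → Dom φ′ x) × (∀ i → Im φ₀ i → Im φ′ i))
mendelsohn-dulmage {n} {r} {B} {φ₀} {φ} φ₀-matches φ-matches = reassign (northUpTo (differs φ) n) φ φ-matches ≤-refl
  where
  differs? : (ψ : Fin n → Maybe (Fin r)) (x : Fin n) → Dec (ψ x ≢ φ₀ x)
  differs? ψ x = ¬? (ψ x ≟ᴹ φ₀ x)

  differs : (Fin n → Maybe (Fin r)) → Fin n → Bool
  differs ψ x = does (differs? ψ x)

  closer : (ψ : Fin n → Maybe (Fin r)) (x : Fin n) (i : Fin r) → φ₀ x ≡ just i → ¬ Im ψ i →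
    northUpTo (differs (assign ψ x i)) n < northUpTo (differs ψ) n
  closer ψ x i φ₀x≡i i∉Im = northUpTo-strict _ _ still-differs x
    (dec-false (differs? (assign ψ x i) x) (λ differ → differ (trans (assign-here ψ x i) (sym φ₀x≡i))))
    (dec-true (differs? ψ x) (λ ψx≡φ₀x → i∉Im (x , trans ψx≡φ₀x φ₀x≡i)))
    where
    still-differs : ∀ y → differs (assign ψ x i) y ≡ true → differs ψ y ≡ true
    still-differs y d = dec-true (differs? ψ y) (λ ψy≡φ₀y →
      does-sound (differs? (assign ψ x i) y) d (agrees ψy≡φ₀y))
      where
      agrees : ψ y ≡ φ₀ y → assign ψ x i y ≡ φ₀ y
      agrees ψy≡φ₀y with y Fin.≟ x
      ... | yes y≡x = trans (sym φ₀x≡i) (cong φ₀ (sym y≡x))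
      ... | no _ = ψy≡φ₀y

  reassign : (d : ℕ) (ψ : Fin n → Maybe (Fin r)) → Matches B ψ → northUpTo (differs ψ) n ≤ d →
    ∃[ φ′ ] (Matches B φ′ × (∀ x → Dom ψ x → Dom φ′ x) × (∀ i → Im φ₀ i → Im φ′ i))
  reassign d ψ ψ-matches bound with any? (λ x → any? (λ i → φ₀ x ≟ᴹ just i ×-dec ¬? (im? ψ i)))
  ... | no none = ψ , ψ-matches , (λ x x∈Dom → x∈Dom) ,
    λ i (x , φ₀x≡i) → decidable-stable (im? ψ i) (λ i∉Im → none (x , i , φ₀x≡i , i∉Im))
  reassign zero ψ ψ-matches bound | yes (x , i , φ₀x≡i , i∉Im) =
    contradiction bound (<⇒≱ (≤-<-trans z≤n (closer ψ x i φ₀x≡i i∉Im)))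
  reassign (suc d) ψ ψ-matches bound | yes (x , i , φ₀x≡i , i∉Im) =
    let φ′ , φ′-matches , grows , covers = reassign d (assign ψ x i)
          (assign-matches ψ-matches (proj₁ φ₀-matches x i φ₀x≡i) i∉Im)
          (ℕ.≤-pred (≤-trans (closer ψ x i φ₀x≡i i∉Im) bound))
    in φ′ , φ′-matches , (λ y y∈Dom → grows y (assign-Dom ψ x i y∈Dom)) , covers

-- Existence of a matching with maximal index set

anyMaybe? : {r : ℕ} {P : Maybe (Fin r) → Set} → Decidable P → Dec (∃ P)
anyMaybe? {P = P} P? with P? nothing | any? (λ i → P? (just i))
... | yes p | _ = yes (nothing , p)
... | no _ | yes (i , p) = yes (just i , p)
... | no ¬p | no none = no λ { (nothing , p) → ¬p p ; (just i , p) → none (i , p) }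

-- A partial matching is searched for as the vector of its values, where exhaustive search is a
-- recursion over the entries.
anyVec? : {r n : ℕ} {P : Vec (Maybe (Fin r)) n → Set} → Decidable P → Dec (∃ P)
anyVec? {n = zero} P? = map′ (λ p → [] , p) (λ { ([] , p) → p }) (P? [])
anyVec? {n = suc n} P? = map′ (λ (x , v , p) → x ∷ v , p) (λ { (x ∷ v , p) → x , v , p })
  (anyMaybe? (λ x → anyVec? (λ v → P? (x ∷ v))))

matches? : {n r : ℕ} {B : Fin r → Fin n → Set} → (∀ i x → Dec (B i x)) → (φ : Fin n → Maybe (Fin r)) → Dec (Matches B φ)
matches? B? φ =
  all? (λ x → all? (λ i → φ x ≟ᴹ just i →-dec B? i x)) ×-dec
  all? (λ x → all? (λ y → all? (λ i → φ x ≟ᴹ just i →-dec (φ y ≟ᴹ just i →-dec x Fin.≟ y))))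

ImMaximal : {n r : ℕ} → (Fin r → Fin n → Set) → (Fin n → Maybe (Fin r)) → Set
ImMaximal B φ₀ = ∀ φ → Matches B φ → (∀ i → Im φ₀ i → Im φ i) → ∀ i → Im φ i → Im φ₀ i

maximal-matching : {n r : ℕ} {B : Fin r → Fin n → Set} → (∀ i x → Dec (B i x)) →
  ∃[ φ₀ ] (Matches B φ₀ × ImMaximal B φ₀)
maximal-matching {n} {r} {B} B? =
  improve (northUpTo (unused (λ _ → nothing)) r) (λ _ → nothing) ((λ _ _ ()) , (λ _ _ _ ())) ≤-refl
  where
  unused : (Fin n → Maybe (Fin r)) → Fin r → Bool
  unused φ i = does (¬? (im? φ i))

  Better : (Fin n → Maybe (Fin r)) → (Fin n → Maybe (Fin r)) → Set
  Better φ ψ = Matches B ψ × (∀ i → Im φ i → Im ψ i) × ∃[ i ] (Im ψ i × ¬ Im φ i)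

  better? : ∀ φ ψ → Dec (Better φ ψ)
  better? φ ψ = matches? B? ψ ×-dec all? (λ i → im? φ i →-dec im? ψ i) ×-dec any? (λ i → im? ψ i ×-dec ¬? (im? φ i))

  -- The search only sees functions of the form `lookup v`, and a given `ψ` agrees with
  -- `lookup (tabulate ψ)` only pointwise.
  better-resp : ∀ φ {ψ ψ′} → (∀ x → ψ x ≡ ψ′ x) → Better φ ψ → Better φ ψ′
  better-resp φ ψ≗ψ′ ((ψ∈B , ψ-injective) , grows , i , (x , ψx≡i) , i∉Im) =
    ((λ y j eq → ψ∈B y j (trans (ψ≗ψ′ y) eq)) ,
     (λ y z j eqy eqz → ψ-injective y z j (trans (ψ≗ψ′ y) eqy) (trans (ψ≗ψ′ z) eqz))) ,
    (λ j j∈Im → let y , eq = grows j j∈Im in y , trans (sym (ψ≗ψ′ y)) eq) ,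
    i , (x , trans (sym (ψ≗ψ′ x)) ψx≡i) , i∉Im

  fewer : ∀ φ ψ → Better φ ψ → northUpTo (unused ψ) r < northUpTo (unused φ) r
  fewer φ ψ (_ , grows , i , i∈Imψ , i∉Imφ) = northUpTo-strict _ _
    (λ j u → dec-true (¬? (im? φ j)) (λ j∈Im → does-sound (¬? (im? ψ j)) u (grows j j∈Im)))
    i (dec-false (¬? (im? ψ i)) (λ i∉Im → i∉Im i∈Imψ)) (dec-true (¬? (im? φ i)) i∉Imφ)

  improve : (d : ℕ) (φ : Fin n → Maybe (Fin r)) → Matches B φ → northUpTo (unused φ) r ≤ d →
    ∃[ φ₀ ] (Matches B φ₀ × ImMaximal B φ₀)
  improve d φ φ-matches bound with anyVec? (λ v → better? φ (lookup v))
  ... | no none = φ , φ-matches , λ ψ ψ-matches grows i i∈Im → decidable-stable (im? φ i) (λ i∉Im →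
    none (tabulate ψ , better-resp φ (λ x → sym (lookup∘tabulate ψ x)) (ψ-matches , grows , i , i∈Im , i∉Im)))
  improve zero φ φ-matches bound | yes (v , better) =
    contradiction bound (<⇒≱ (≤-<-trans z≤n (fewer φ (lookup v) better)))
  improve (suc d) φ φ-matches bound | yes (v , better) =
    improve d (lookup v) (proj₁ better) (ℕ.≤-pred (≤-trans (fewer φ (lookup v) better) bound))

-- Exchange keeps the domain of `φ` and adds the indices of `φ₀`; maximality then forbids any
-- further index. Hence every independent set lies in one matched by exactly the indices of `φ₀`.
extend-to : {n r : ℕ} {B : Fin r → Fin n → Set} {φ₀ : Fin n → Maybe (Fin r)} →
  Matches B φ₀ → ImMaximal B φ₀ → (φ : Fin n → Maybe (Fin r)) → Matches B φ →
  ∃[ φ′ ] (Matches B φ′ × (∀ x → Dom φ x → Dom φ′ x) × (∀ i → Im φ₀ i → Im φ′ i) × (∀ i → Im φ′ i → Im φ₀ i))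
extend-to φ₀-matches maximal φ φ-matches =
  let φ′ , φ′-matches , grows , covers = mendelsohn-dulmage φ₀-matches φ-matches
  in φ′ , φ′-matches , grows , covers , maximal φ′ φ′-matches covers

neverAbove : {n : ℕ} (p q : Fin n → Bool) → (∀ b → b ≤ n → northUpTo p b ≤ northUpTo q b) → NeverAbove p q
neverAbove {n} p q below b with b ≤? n
... | yes b≤n = below b b≤n
... | no b≰n = subst₂ _≤_ (sym (northUpTo-saturated p n≤b)) (sym (northUpTo-saturated q n≤b)) (below n ≤-refl)
  where
  n≤b : n ≤ b
  n≤b = <⇒≤ (≰⇒> b≰n)

-- A matching bounds counts in two directions: here its injectivity embeds elements into indices,
-- while in `dom-prefix-≥` its single-valuedness embeds indices into elements.
dom-prefix-≤ : {n r : ℕ} {B : Fin r → Fin n → Set} {φ : Fin n → Maybe (Fin r)} → Matches B φ →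
  (q : Fin r → Bool) (b c : ℕ) →
  (∀ x i → toℕ x < b → φ x ≡ just i → toℕ i < c × q i ≡ true) → northUpTo (dom φ) b ≤ northUpTo q c
dom-prefix-≤ {φ = φ} (_ , φ-injective) q b c into = northUpTo-pigeonhole (dom φ) q b c (λ x i → φ x ≡ just i)
  (λ x x<b x∈Dom → let i , φx≡i = dom-sound φ x∈Dom
                       i<c , qi = into x i x<b φx≡i
                   in i , i<c , qi , φx≡i)
  (λ eq eq′ → φ-injective _ _ _ eq eq′)

dom-prefix-≥ : {n r : ℕ} (φ : Fin n → Maybe (Fin r)) (q : Fin r → Bool) (b c : ℕ) →
  (∀ i → toℕ i < c → q i ≡ true → ∃[ x ] (toℕ x < b × φ x ≡ just i)) → northUpTo q c ≤ northUpTo (dom φ) b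
dom-prefix-≥ φ q b c onto = northUpTo-pigeonhole q (dom φ) c b (λ i x → φ x ≡ just i)
  (λ i i<c qi → let x , x<b , φx≡i = onto i i<c qi in x , x<b , cong is-just φx≡i , φx≡i)
  (λ eq eq′ → just-injective (trans (sym eq) eq′))

-- Paths with prescribed counts

-- The height functions of lattice paths with `N` steps; `pathOf` recovers the path.
record PathCount (N : ℕ) (c : ℕ → ℕ) : Set where
  field
    start : c 0 ≡ 0
    mono  : ∀ b → b < N → c b ≤ c (suc b)
    step  : ∀ b → b < N → c (suc b) ≤ suc (c b)

pathOf : (N : ℕ) → (ℕ → ℕ) → Fin N → Bool
pathOf N c x = does (c (toℕ x) <? c (suc (toℕ x)))

pathOf-count : {N : ℕ} {c : ℕ → ℕ} → PathCount N c → ∀ b → b ≤ N → northUpTo (pathOf N c) b ≡ c b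
pathOf-count {N} {c} pc zero _ = trans (northUpTo-zero (pathOf N c)) (sym (PathCount.start pc))
pathOf-count {N} {c} pc (suc b) b<N = begin
  northUpTo (pathOf N c) (suc b)        ≡⟨ cong (northUpTo (pathOf N c) ∘ suc) (sym toℕx≡b) ⟩
  northUpTo (pathOf N c) (suc (toℕ x))  ≡⟨ northUpTo-step (pathOf N c) x ⟩
  northUpTo (pathOf N c) (toℕ x) + bit (does (c (toℕ x) <? c (suc (toℕ x))))
    ≡⟨ cong (λ a → northUpTo (pathOf N c) a + bit (does (c a <? c (suc a)))) toℕx≡b ⟩
  northUpTo (pathOf N c) b + bit (does (c b <? c (suc b)))
    ≡⟨ cong (_+ bit (does (c b <? c (suc b)))) (pathOf-count pc b (<⇒≤ b<N)) ⟩
  c b + bit (does (c b <? c (suc b)))   ≡⟨ increment (c b <? c (suc b)) ⟩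
  c (suc b)                             ∎
  where
  open ≡-Reasoning
  x : Fin N
  x = fromℕ< b<N

  toℕx≡b : toℕ x ≡ b
  toℕx≡b = toℕ-fromℕ< b<N

  increment : (d : Dec (c b < c (suc b))) → c b + bit (does d) ≡ c (suc b)
  increment (yes up) = trans (ℕ.+-comm (c b) 1) (≤-antisym up (PathCount.step pc b b<N))
  increment (no ¬up) = trans (ℕ.+-comm (c b) 0) (≤-antisym (PathCount.mono pc b b<N) (≮⇒≥ ¬up))

northUpTo-pathCount : {N : ℕ} (p : Fin N → Bool) → PathCount N (northUpTo p)
northUpTo-pathCount {N} p = record
  { start = northUpTo-zero p
  ; mono = λ b _ → northUpTo-mono p (n≤1+n b)
  ; step = step
  }
  where
  bit≤1 : (t : Bool) → bit t ≤ 1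
  bit≤1 true = ≤-refl
  bit≤1 false = z≤n

  step : ∀ b → b < N → northUpTo p (suc b) ≤ suc (northUpTo p b)
  step b b<N = subst (λ a → northUpTo p (suc a) ≤ suc (northUpTo p a)) (toℕ-fromℕ< b<N)
    (≤-trans (≤-reflexive (northUpTo-step p x))
      (≤-trans (ℕ.+-monoʳ-≤ (northUpTo p (toℕ x)) (bit≤1 (p x))) (≤-reflexive (ℕ.+-comm (northUpTo p (toℕ x)) 1))))
    where
    x : Fin N
    x = fromℕ< b<N

-- `U` may jump by more than one; climbing by one whenever `U` allows it gives the largest height
-- function below a monotone `U`.
highest : (ℕ → ℕ) → ℕ → ℕ
highest U zero = 0
highest U (suc b) = suc (highest U b) ⊓ U (suc b)

highest-≤ : (U : ℕ → ℕ) (b : ℕ) → highest U b ≤ U b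
highest-≤ U zero = z≤n
highest-≤ U (suc b) = ℕ.m⊓n≤n (suc (highest U b)) (U (suc b))

highest-pathCount : (U : ℕ → ℕ) → (∀ b → U b ≤ U (suc b)) → (N : ℕ) → PathCount N (highest U)
highest-pathCount U U-mono N = record
  { start = refl
  ; mono = λ b _ → ℕ.⊓-glb (n≤1+n (highest U b)) (≤-trans (highest-≤ U b) (U-mono b))
  ; step = λ b _ → ℕ.m⊓n≤m (suc (highest U b)) (U (suc b))
  }

highest-greatest : {N : ℕ} {c : ℕ → ℕ} (U : ℕ → ℕ) → PathCount N c → (∀ b → c b ≤ U b) →
  ∀ b → b ≤ N → c b ≤ highest U b
highest-greatest U pc c≤U zero _ = ≤-reflexive (PathCount.start pc)
highest-greatest U pc c≤U (suc b) b<N = ℕ.⊓-glb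
  (≤-trans (PathCount.step pc b b<N) (s≤s (highest-greatest U pc c≤U b (<⇒≤ b<N)))) (c≤U (suc b))

-- lowestBefore L k b d is the count at position b, with d steps left before the final count k.
lowestBefore : (ℕ → ℕ) → ℕ → ℕ → ℕ → ℕ
lowestBefore L k b zero = k
lowestBefore L k b (suc d) = L b ⊔ pred (lowestBefore L k (suc b) d)

-- The mirror image of `highest`, computed backwards from the final height `k`: one step earlier the
-- path is lower by one unless `L` or zero forbids it.
lowest : (ℕ → ℕ) → ℕ → ℕ → ℕ → ℕ
lowest L k N b = lowestBefore L k b (N ∸ b)

lowest-end : (L : ℕ → ℕ) (k N : ℕ) → lowest L k N N ≡ k
lowest-end L k N = cong (lowestBefore L k N) (ℕ.n∸n≡0 N)

lowest-unfold : (L : ℕ → ℕ) (k : ℕ) {N b : ℕ} → b < N → lowest L k N b ≡ L b ⊔ pred (lowest L k N (suc b))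
lowest-unfold L k {b = b} (s≤s b≤N) = cong (lowestBefore L k b) (ℕ.+-∸-assoc 1 b≤N)

lowest-≥ : (L : ℕ → ℕ) {k N : ℕ} → L N ≤ k → ∀ b → b ≤ N → L b ≤ lowest L k N b
lowest-≥ L {k} {N} LN≤k b b≤N with ℕ.m≤n⇒m<n∨m≡n b≤N
... | inj₁ b<N = ≤-trans (ℕ.m≤m⊔n (L b) _) (≤-reflexive (sym (lowest-unfold L k b<N)))
... | inj₂ refl = ≤-trans LN≤k (≤-reflexive (sym (lowest-end L k N)))

lowest-least : {N : ℕ} {c : ℕ → ℕ} (L : ℕ → ℕ) → PathCount N c → (∀ b → L b ≤ c b) →
  ∀ b → b ≤ N → lowest L (c N) N b ≤ c b
lowest-least {N} {c} L pc L≤c b b≤N = before (N ∸ b) b (ℕ.m+[n∸m]≡n b≤N)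
  where
  before : ∀ d b → b + d ≡ N → lowestBefore L (c N) b d ≤ c b
  before zero b eq = ≤-reflexive (cong c (trans (sym eq) (ℕ.+-identityʳ b)))
  before (suc d) b eq = ℕ.⊔-lub (L≤c b)
    (≤-trans (ℕ.pred-mono-≤ (before d (suc b) b+d≡N)) (ℕ.pred-mono-≤ (PathCount.step pc b b<N)))
    where
    b+d≡N : suc b + d ≡ N
    b+d≡N = trans (sym (ℕ.+-suc b d)) eq

    b<N : b < N
    b<N = ≤-trans (ℕ.m≤m+n (suc b) d) (≤-reflexive b+d≡N)

-- The lowest path stays at or below the given height function `c`, and this forces it to start at
-- 0.
lowest-pathCount : {N : ℕ} {c : ℕ → ℕ} (L : ℕ → ℕ) → PathCount N c → (∀ b → L b ≤ c b) → (∀ b → L b ≤ L (suc b)) →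
  PathCount N (lowest L (c N) N)
lowest-pathCount {N} {c} L pc L≤c L-mono = record
  { start = ℕ.n≤0⇒n≡0 (≤-trans (lowest-least L pc L≤c 0 z≤n) (≤-reflexive (PathCount.start pc)))
  ; mono = λ b b<N → ≤-trans (≤-reflexive (lowest-unfold L k b<N))
      (ℕ.⊔-lub (≤-trans (L-mono b) (lowest-≥ L (L≤c N) (suc b) b<N)) (ℕ.pred[n]≤n {lowest L k N (suc b)}))
  ; step = λ b b<N → ≤-trans (ℕ.m≤n+m∸n (lowest L k N (suc b)) 1)
      (s≤s (≤-trans (ℕ.m≤n⊔m (L b) _) (≤-reflexive (sym (lowest-unfold L k b<N)))))
  }
  where
  k : ℕ
  k = c N

-- Lattice path matroids

-- The North steps of `R`, in order of position, are matched with the indices counted from 0, so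
-- every index is used.
module PathMatching {n r : ℕ} (R : Fin n → Bool) (count : northUpTo R n ≡ r) where

  index< : ∀ x → R x ≡ true → northUpTo R (toℕ x) < r
  index< x Rx = <-≤-trans (northUpTo-< R x Rx (toℕ<n x)) (≤-reflexive count)

  indexIf : ∀ x → Dec (R x ≡ true) → Maybe (Fin r)
  indexIf x (yes Rx) = just (fromℕ< (index< x Rx))
  indexIf x (no _) = nothing

  match : Fin n → Maybe (Fin r)
  match x = indexIf x (R x Bool.≟ true)

  match-sound : ∀ x i → match x ≡ just i → R x ≡ true × northUpTo R (toℕ x) ≡ toℕ i
  match-sound x i eq with R x Bool.≟ true
  match-sound x i refl | yes Rx = Rx , sym (toℕ-fromℕ< (index< x Rx))

  match-complete : ∀ x i → R x ≡ true → northUpTo R (toℕ x) ≡ toℕ i → match x ≡ just i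
  match-complete x i Rx eq with R x Bool.≟ true
  ... | yes Rx′ = cong just (toℕ-injective (trans (toℕ-fromℕ< (index< x Rx′)) eq))
  ... | no ¬Rx = contradiction Rx ¬Rx

  match-Dom : ∀ x → R x ≡ true → Dom match x
  match-Dom x Rx = fromℕ< (index< x Rx) , match-complete x _ Rx (sym (toℕ-fromℕ< (index< x Rx)))

  match-onto : ∀ i → Im match i
  match-onto i =
    let x , _ , Rx , eq = select R n (<-≤-trans (toℕ<n i) (≤-reflexive (sym count)))
    in x , match-complete x i Rx eq

  match-injective : ∀ x y i → match x ≡ just i → match y ≡ just i → x ≡ y
  match-injective x y i eqx eqy =
    let Rx , cx = match-sound x i eqx
        Ry , cy = match-sound y i eqy
    in northUpTo-injective R x y Rx Ry (trans cx (sym cy))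

module PathsBetween (m r : ℕ) (P Q : Fin (m + r) → Bool)
  (P-path : IsLatticePath m r P) (Q-path : IsLatticePath m r Q) (P≤Q : NeverAbove P Q) where

  path-matches : (R : Fin (m + r) → Bool) (R-path : IsLatticePath m r R) → NeverAbove P R → NeverAbove R Q →
    Matches (NSet m r P Q) (PathMatching.match R R-path)
  path-matches R R-path P≤R R≤Q =
    (λ x i eq → let Rx , c = match-sound x i eq in R , R-path , P≤R , R≤Q , Rx , c) , match-injective
    where open PathMatching R R-path

  subpath-independent : (R : Fin (m + r) → Bool) → IsLatticePath m r R → NeverAbove P R → NeverAbove R Q →
    (X : Subset (m + r)) → (∀ x → x ∈ X → R x ≡ true) → LPMIndep m r P Q X
  subpath-independent R R-path P≤R R≤Q X X⊆R = covers⇒transversal X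
    (PathMatching.match R R-path , path-matches R R-path P≤R R≤Q , λ x x∈X → PathMatching.match-Dom R R-path x (X⊆R x x∈X))

  -- If `x` is matched to `i`, some path between `P` and `Q` has height `i` just before its North
  -- step `x`. So an index below the height of `P` at `b` has its partner before `b`, and an element
  -- before `b` gets an index below the height of `Q` at `b`.
  onto⇒between : (φ : Fin (m + r) → Maybe (Fin r)) → Matches (NSet m r P Q) φ → (∀ i → Im φ i) →
    ∀ b → b ≤ m + r → northUpTo P b ≤ northUpTo (dom φ) b × northUpTo (dom φ) b ≤ northUpTo Q b
  onto⇒between φ φ-matches onto b b≤N = above , below
    where
    above : northUpTo P b ≤ northUpTo (dom φ) b
    above = subst (_≤ northUpTo (dom φ) b)
      (northUpTo-all (≤-trans (northUpTo-mono P b≤N) (≤-reflexive P-path)))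
      (dom-prefix-≥ φ (λ _ → true) b (northUpTo P b) early)
      where
      early : ∀ i → toℕ i < northUpTo P b → true ≡ true → ∃[ x ] (toℕ x < b × φ x ≡ just i)
      early i i<Pb _ with onto i
      ... | x , φx≡i with toℕ x <? b
      ... | yes x<b = x , x<b , φx≡i
      ... | no x≮b =
        let R , _ , P≤R , _ , _ , Rx≡i = proj₁ φ-matches x i φx≡i
        in contradiction i<Pb (≤⇒≯ (≤-trans (northUpTo-mono P (≮⇒≥ x≮b)) (≤-trans (P≤R (toℕ x)) (≤-reflexive Rx≡i))))

    below : northUpTo (dom φ) b ≤ northUpTo Q b
    below = ≤-trans (dom-prefix-≤ φ-matches (λ _ → true) b (northUpTo Q b) bounded)
        (northUpTo-≤ {r} (λ _ → true) (northUpTo Q b))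
      where
      bounded : ∀ x i → toℕ x < b → φ x ≡ just i → toℕ i < northUpTo Q b × true ≡ true
      bounded x i x<b φx≡i =
        let R , _ , _ , R≤Q , Rx , Rx≡i = proj₁ φ-matches x i φx≡i
        in ≤-trans (≤-reflexive (cong suc (sym Rx≡i))) (≤-trans (northUpTo-< R x Rx x<b) (R≤Q b)) , refl

  -- The North steps of `P` give a matching onto all indices. Exchange with it extends the matching
  -- of `X` to one onto all indices, whose domain is the required path.
  independent⇒subpath : (X : Subset (m + r)) → LPMIndep m r P Q X →
    Σ (Fin (m + r) → Bool) λ R → (∀ x → x ∈ X → R x ≡ true) ×
      (∀ b → b ≤ m + r → northUpTo P b ≤ northUpTo R b × northUpTo R b ≤ northUpTo Q b)
  independent⇒subpath X independent =
    let φ , φ-matches , covered = transversal⇒covers X independent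
        φ′ , φ′-matches , grows , onto = mendelsohn-dulmage
          (path-matches P P-path (λ b → ≤-refl) P≤Q) φ-matches
    in dom φ′ , (λ x x∈X → dom-complete φ′ (grows x (covered x x∈X))) ,
       onto⇒between φ′ φ′-matches (λ i → onto i (PathMatching.match-onto P P-path i))

-- Families of intervals with weakly increasing endpoints

-- uncross says that both endpoints increase weakly with i, in a form that puts no condition on empty members.
record IsMonotoneFamily {n r : ℕ} (D : Fin r → Fin n → Set) : Set where
  field
    convex  : ∀ i {x y z} → toℕ x < toℕ y → toℕ y < toℕ z → D i x → D i z → D i y
    uncross : ∀ {i i′ x y} → toℕ i < toℕ i′ → toℕ x < toℕ y → D i y → D i′ x → D i x × D i′ y

module MonotoneFamily {n r : ℕ} (D : Fin r → Fin n → Set) (D? : ∀ i x → Dec (D i x)) (monotone : IsMonotoneFamily D)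
  (φ₀ : Fin n → Maybe (Fin r)) (φ₀-matches : Matches D φ₀) (φ₀-maximal : ImMaximal D φ₀) where

  open IsMonotoneFamily monotone

  used : Fin r → Bool
  used i = does (im? φ₀ i)

  used-complete : ∀ {i} → Im φ₀ i → used i ≡ true
  used-complete {i} = dec-true (im? φ₀ i)

  rank : ℕ
  rank = northUpTo used r

  Started : ℕ → Fin r → Set
  Started b i = Im φ₀ i × ∃[ x ] (toℕ x < b × D i x)

  started? : ∀ b i → Dec (Started b i)
  started? b i = im? φ₀ i ×-dec any? (λ x → toℕ x <? b ×-dec D? i x)

  Finished : ℕ → Fin r → Set
  Finished b i = Im φ₀ i × ¬ (∃[ x ] (b ≤ toℕ x × D i x))

  finished? : ∀ b i → Dec (Finished b i)
  finished? b i = im? φ₀ i ×-dec ¬? (any? (λ x → b ≤? toℕ x ×-dec D? i x))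

  upper lower : ℕ → ℕ
  upper b = northUpTo (λ i → does (started? b i)) r
  lower b = northUpTo (λ i → does (finished? b i)) r

  upper-mono : ∀ b → upper b ≤ upper (suc b)
  upper-mono b = northUpTo-⊆ _ _ λ i s →
    let i∈Im , x , x<b , Dix = does-sound (started? b i) s
    in dec-true (started? (suc b) i) (i∈Im , x , ≤-trans x<b (n≤1+n b) , Dix)

  lower-mono : ∀ b → lower b ≤ lower (suc b)
  lower-mono b = northUpTo-⊆ _ _ λ i f →
    let i∈Im , none = does-sound (finished? b i) f
    in dec-true (finished? (suc b) i) (i∈Im , λ (x , b<x , Dix) → none (x , <⇒≤ b<x , Dix))

  upper≤rank : ∀ b → upper b ≤ rank
  upper≤rank b = northUpTo-⊆ _ _ λ i s → used-complete (proj₁ (does-sound (started? b i) s))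

  lower≤rank : ∀ b → lower b ≤ rank
  lower≤rank b = northUpTo-⊆ _ _ λ i f → used-complete (proj₁ (does-sound (finished? b i) f))

  -- An element before `b` can only be matched to a set started before `b`, and a set finished
  -- before `b` must have its partner there. This yields both bounds on each prefix.
  module Basis (φ : Fin n → Maybe (Fin r)) (φ-matches : Matches D φ)
    (Im⊇ : ∀ i → Im φ₀ i → Im φ i) (Im⊆ : ∀ i → Im φ i → Im φ₀ i) where

    basis-≤-upper : ∀ b → northUpTo (dom φ) b ≤ upper b
    basis-≤-upper b = dom-prefix-≤ φ-matches _ b r λ x i x<b φx≡i →
      toℕ<n i , dec-true (started? b i) (Im⊆ i (x , φx≡i) , x , x<b , proj₁ φ-matches x i φx≡i)

    basis-≥-lower : ∀ b → lower b ≤ northUpTo (dom φ) b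
    basis-≥-lower b = dom-prefix-≥ φ _ b r λ i _ f →
      let i∈Im , none = does-sound (finished? b i) f
          x , φx≡i = Im⊇ i i∈Im
      in x , ℕ.≰⇒> (λ b≤x → none (x , b≤x , proj₁ φ-matches x i φx≡i)) , φx≡i

    basis-rank : northUpTo (dom φ) n ≡ rank
    basis-rank = ≤-antisym (≤-trans (basis-≤-upper n) (upper≤rank n))
      (dom-prefix-≥ φ used n r λ i _ u →
        let x , φx≡i = Im⊇ i (does-sound (im? φ₀ i) u) in x , toℕ<n x , φx≡i)

  module Basis₀ = Basis φ₀ φ₀-matches (λ i i∈Im → i∈Im) (λ i i∈Im → i∈Im)

  rank≤n : rank ≤ n
  rank≤n = ≤-trans (≤-reflexive (sym Basis₀.basis-rank)) (northUpTo-≤ (dom φ₀) n)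

  -- The c-th element x of a path lying between the two bounds belongs to the c-th used set i: by the upper bound some
  -- used set of index ≥ i meets [0,x], by the lower bound some used set of index ≤ i meets [x,n), and D i is nonempty.
  slot : (R : Fin n → Bool) → northUpTo R n ≡ rank →
    (∀ b → b ≤ n → lower b ≤ northUpTo R b × northUpTo R b ≤ upper b) →
    ∀ x → R x ≡ true → ∃[ i ] (D i x × used i ≡ true × northUpTo used (toℕ i) ≡ northUpTo R (toℕ x))
  slot R R-rank bounds x Rx =
    let i , _ , ui , rank-i = select used r (<-≤-trans (northUpTo-< R x Rx (toℕ<n x)) (≤-reflexive R-rank))
    in i , member i ui rank-i , ui , rank-i
    where
    module _ (i : Fin r) (ui : used i ≡ true) (rank-i : northUpTo used (toℕ i) ≡ northUpTo R (toℕ x)) where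

      rank-suc : northUpTo used (suc (toℕ i)) ≡ northUpTo R (suc (toℕ x))
      rank-suc = trans (northUpTo-north used i ui) (trans (cong suc rank-i) (sym (northUpTo-north R x Rx)))

      -- The upper bound is taken at `suc (toℕ x)` so that `x` itself counts: by then more sets have
      -- started than there are used sets before `i`.
      later : ∃[ j ] (toℕ i ≤ toℕ j × ∃[ y ] (toℕ y ≤ toℕ x × D j y))
      later =
        let j , _ , s , not-before = northUpTo-excess (λ j → does (started? (suc (toℕ x)) j)) used r (toℕ i)
              (≤-trans (≤-reflexive (trans (sym (northUpTo-north used i ui)) rank-suc))
                (proj₂ (bounds (suc (toℕ x)) (toℕ<n x))))
            j∈Im , y , y<1+x , Djy = does-sound (started? (suc (toℕ x)) j) s
        in j , ≮⇒≥ (λ j<i → not-before (j<i , used-complete j∈Im)) , y , ℕ.≤-pred y<1+x , Djy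

      -- The lower bound is taken at `toℕ x`, before `x`: fewer sets are finished there than there
      -- are used sets up to and including `i`.
      earlier : ∃[ j ] (toℕ j ≤ toℕ i × ∃[ z ] (toℕ x ≤ toℕ z × D j z))
      earlier =
        let j , j<1+i , uj , not-finished = northUpTo-excess used (λ j → does (finished? (toℕ x) j)) (suc (toℕ i)) r
              (≤-<-trans (proj₁ (bounds (toℕ x) (<⇒≤ (toℕ<n x))))
                (≤-reflexive (trans (cong suc (sym rank-i)) (sym (northUpTo-north used i ui)))))
        in j , ℕ.≤-pred j<1+i , decidable-stable (any? (λ z → toℕ x ≤? toℕ z ×-dec D? j z))
             (λ none → not-finished (toℕ<n j , dec-true (finished? (toℕ x) j) (does-sound (im? φ₀ j) uj , none)))

      -- `D i` contains `w` to the left of `x`, and a set of no larger index reaches some `z` at or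
      -- beyond `x`. Uncrossing puts `z` into `D i`, and convexity fills in `x`; `reach-left` is
      -- symmetric.
      reach-right : ∀ {w} → toℕ w < toℕ x → D i w → D i x
      reach-right w<x Diw with earlier
      ... | j , j≤i , z , x≤z , Djz = between (far (ℕ.m≤n⇒m<n∨m≡n j≤i))
        where
        far : toℕ j < toℕ i ⊎ toℕ j ≡ toℕ i → D i z
        far (inj₁ j<i) = proj₂ (uncross j<i (<-≤-trans w<x x≤z) Djz Diw)
        far (inj₂ j≡i) = subst (λ j → D j z) (toℕ-injective j≡i) Djz

        between : D i z → D i x
        between Diz with ℕ.m≤n⇒m<n∨m≡n x≤z
        ... | inj₁ x<z = convex i w<x x<z Diw Diz
        ... | inj₂ x≡z = subst (D i) (sym (toℕ-injective x≡z)) Diz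

      reach-left : ∀ {w} → toℕ x < toℕ w → D i w → D i x
      reach-left x<w Diw with later
      ... | j , i≤j , y , y≤x , Djy = between (far (ℕ.m≤n⇒m<n∨m≡n i≤j))
        where
        far : toℕ i < toℕ j ⊎ toℕ i ≡ toℕ j → D i y
        far (inj₁ i<j) = proj₁ (uncross i<j (≤-<-trans y≤x x<w) Diw Djy)
        far (inj₂ i≡j) = subst (λ j → D j y) (sym (toℕ-injective i≡j)) Djy

        between : D i y → D i x
        between Diy with ℕ.m≤n⇒m<n∨m≡n y≤x
        ... | inj₁ y<x = convex i y<x x<w Diy Diw
        ... | inj₂ y≡x = subst (D i) (toℕ-injective y≡x) Diy

      member : D i x
      member with does-sound (im? φ₀ i) ui
      ... | w , φ₀w≡i with <-cmp (toℕ w) (toℕ x)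
      ... | tri< w<x _ _ = reach-right w<x (proj₁ φ₀-matches w i φ₀w≡i)
      ... | tri≈ _ w≡x _ = subst (D i) (toℕ-injective w≡x) (proj₁ φ₀-matches w i φ₀w≡i)
      ... | tri> _ _ x<w = reach-left x<w (proj₁ φ₀-matches w i φ₀w≡i)

  bounded⇒independent : (R : Fin n → Bool) → northUpTo R n ≡ rank →
    (∀ b → b ≤ n → lower b ≤ northUpTo R b × northUpTo R b ≤ upper b) →
    (X : Subset n) → (∀ x → x ∈ X → R x ≡ true) → PartialTransversal D X
  bounded⇒independent R R-rank bounds X X⊆R =
    (λ x x∈X → proj₁ (slot-of x x∈X)) ,
    (λ x x∈X → proj₁ (proj₂ (slot-of x x∈X))) ,
    λ x y x∈X y∈X eq →
      let _ , _ , _ , rank-x = slot-of x x∈X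
          _ , _ , _ , rank-y = slot-of y y∈X
      in northUpTo-injective R x y (X⊆R x x∈X) (X⊆R y y∈X)
           (trans (sym rank-x) (trans (cong (northUpTo used ∘ toℕ) eq) rank-y))
    where
    slot-of : ∀ x → x ∈ X → ∃[ i ] (D i x × used i ≡ true × northUpTo used (toℕ i) ≡ northUpTo R (toℕ x))
    slot-of x x∈X = slot R R-rank bounds x (X⊆R x x∈X)

  independent⇒basis : (X : Subset n) → PartialTransversal D X →
    Σ (Fin n → Bool) λ R → (∀ x → x ∈ X → R x ≡ true) × northUpTo R n ≡ rank ×
      (∀ b → lower b ≤ northUpTo R b) × (∀ b → northUpTo R b ≤ upper b)
  independent⇒basis X independent =
    let φ , φ-matches , covered = transversal⇒covers X independent
        φ′ , φ′-matches , grows , Im⊇ , Im⊆ = extend-to φ₀-matches φ₀-maximal φ φ-matches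
        open Basis φ′ φ′-matches Im⊇ Im⊆
    in dom φ′ , (λ x x∈X → dom-complete φ′ (grows x (covered x x∈X))) , basis-rank , basis-≥-lower , basis-≤-upper

  lowest-count : PathCount n (lowest lower rank n)
  lowest-count = subst (λ k → PathCount n (lowest lower k n)) Basis₀.basis-rank
    (lowest-pathCount lower (northUpTo-pathCount (dom φ₀)) Basis₀.basis-≥-lower lower-mono)

  P Q : Fin n → Bool
  P = pathOf n (lowest lower rank n)
  Q = pathOf n (highest upper)

  P-count : ∀ b → b ≤ n → northUpTo P b ≡ lowest lower rank n b
  P-count = pathOf-count lowest-count

  Q-count : ∀ b → b ≤ n → northUpTo Q b ≡ highest upper b
  Q-count = pathOf-count (highest-pathCount upper upper-mono n)

  bounded⇒P≤ : (R : Fin n → Bool) → northUpTo R n ≡ rank → (∀ b → lower b ≤ northUpTo R b) → NeverAbove P R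
  bounded⇒P≤ R R-rank above = neverAbove P R λ b b≤n → ≤-trans (≤-reflexive (P-count b b≤n))
    (subst (λ k → lowest lower k n b ≤ northUpTo R b) R-rank (lowest-least lower (northUpTo-pathCount R) above b b≤n))

  bounded⇒≤Q : (R : Fin n → Bool) → (∀ b → northUpTo R b ≤ upper b) → NeverAbove R Q
  bounded⇒≤Q R below = neverAbove R Q λ b b≤n → ≤-trans
    (highest-greatest upper (northUpTo-pathCount R) below b b≤n) (≤-reflexive (sym (Q-count b b≤n)))

  P-rank : northUpTo P n ≡ rank
  P-rank = trans (P-count n ≤-refl) (lowest-end lower rank n)

  -- The unit-step restriction might keep `highest upper` from reaching `rank`; the path given by
  -- the domain of `φ₀` lies below it and does reach `rank`.
  Q-rank : northUpTo Q n ≡ rank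
  Q-rank = ≤-antisym
    (≤-trans (≤-reflexive (Q-count n ≤-refl)) (≤-trans (highest-≤ upper n) (upper≤rank n)))
    (≤-trans (≤-reflexive (sym Basis₀.basis-rank)) (bounded⇒≤Q (dom φ₀) Basis₀.basis-≤-upper n))

  P≤Q : NeverAbove P Q
  P≤Q b = ≤-trans (bounded⇒P≤ (dom φ₀) Basis₀.basis-rank Basis₀.basis-≥-lower b)
    (bounded⇒≤Q (dom φ₀) Basis₀.basis-≤-upper b)

  between⇒bounded : (R : Fin n → Bool) →
    (∀ b → b ≤ n → northUpTo P b ≤ northUpTo R b × northUpTo R b ≤ northUpTo Q b) →
    ∀ b → b ≤ n → lower b ≤ northUpTo R b × northUpTo R b ≤ upper b
  between⇒bounded R between b b≤n =
    ≤-trans (lowest-≥ lower (lower≤rank n) b b≤n) (≤-trans (≤-reflexive (sym (P-count b b≤n))) (proj₁ (between b b≤n))) ,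
    ≤-trans (proj₂ (between b b≤n)) (≤-trans (≤-reflexive (Q-count b b≤n)) (highest-≤ upper b))

  between⇒rank : (R : Fin n → Bool) →
    (∀ b → b ≤ n → northUpTo P b ≤ northUpTo R b × northUpTo R b ≤ northUpTo Q b) → northUpTo R n ≡ rank
  between⇒rank R between = ≤-antisym
    (≤-trans (proj₂ (between n ≤-refl)) (≤-reflexive Q-rank))
    (≤-trans (≤-reflexive (sym P-rank)) (proj₁ (between n ≤-refl)))

-- The size `m + r` is an index, so matching on `lpm` identifies it with the size of the ground set
-- without transport.
data IsLPM : (n : ℕ) → Indep n → Set₁ where
  lpm : {m r : ℕ} {I : Indep (m + r)} (P Q : Fin (m + r) → Bool) → IsLatticePath m r P → IsLatticePath m r Q →
    NeverAbove P Q → (∀ X → I X ⇔ LPMIndep m r P Q X) → IsLPM (m + r) I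

monotone-family-isLPM : {n s : ℕ} (D : Fin s → Fin n → Set) → (∀ i x → Dec (D i x)) → IsMonotoneFamily D →
  IsLPM n (PartialTransversal D)
monotone-family-isLPM {n} {s} D D? monotone =
  let φ₀ , φ₀-matches , φ₀-maximal = maximal-matching D?
      open MonotoneFamily D D? monotone φ₀ φ₀-matches φ₀-maximal
  in with-rank D D? monotone φ₀ φ₀-matches φ₀-maximal (n ∸ rank) rank (ℕ.m∸n+n≡m rank≤n) refl
  where
  -- With `m` and `r` as variables the equation `m + r ≡ n` can be eliminated; at the call `m` is
  -- `n ∸ rank`.
  with-rank : {n : ℕ} (D : Fin s → Fin n → Set) (D? : ∀ i x → Dec (D i x)) → IsMonotoneFamily D →
    (φ₀ : Fin n → Maybe (Fin s)) → Matches D φ₀ → ImMaximal D φ₀ →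
    (m r : ℕ) → m + r ≡ n → northUpTo (λ i → does (im? φ₀ i)) s ≡ r → IsLPM n (PartialTransversal D)
  with-rank D D? monotone φ₀ φ₀-matches φ₀-maximal m r refl rank≡r =
    lpm P Q P-path Q-path P≤Q λ X → mk⇔
      (λ independent →
        let R , X⊆R , R-rank , above , below = independent⇒basis X independent
        in subpath-independent R (trans R-rank rank≡r) (bounded⇒P≤ R R-rank above) (bounded⇒≤Q R below) X X⊆R)
      (λ independent →
        let R , X⊆R , between = independent⇒subpath X independent
        in bounded⇒independent R (between⇒rank R between) (between⇒bounded R between) X X⊆R)
    where
    open MonotoneFamily D D? monotone φ₀ φ₀-matches φ₀-maximal

    P-path : IsLatticePath m r P
    P-path = trans P-rank rank≡r

    Q-path : IsLatticePath m r Q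
    Q-path = trans Q-rank rank≡r

    open PathsBetween m r P Q P-path Q-path P≤Q

-- Cyclic permutations

iter-+ : {n : ℕ} (σ : Permutation′ n) (a b : ℕ) (x : Fin n) → iter σ (a + b) x ≡ iter σ a (iter σ b x)
iter-+ σ zero b x = refl
iter-+ σ (suc a) b x = cong (σ ⟨$⟩ʳ_) (iter-+ σ a b x)

iter-injective : {n : ℕ} (σ : Permutation′ n) (a : ℕ) {x y : Fin n} → iter σ a x ≡ iter σ a y → x ≡ y
iter-injective σ zero eq = eq
iter-injective σ (suc a) eq =
  iter-injective σ a (trans (sym (inverseˡ σ)) (trans (cong (σ ⟨$⟩ˡ_) eq) (inverseˡ σ)))

module Orbit {n : ℕ} (σ : Permutation′ n) (cyclic : IsCyclic σ) (o : Fin n) where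

  -- The remainder modulo `p`, found by counting up and returning to 0 at `p`. The bound `d ≤ k` is
  -- what `distance-≤` rests on.
  reduce : (p : ℕ) → 0 < p → iter σ p o ≡ o → ∀ k → ∃[ d ] (d < p × d ≤ k × iter σ d o ≡ iter σ k o)
  reduce p 0<p _ zero = 0 , 0<p , z≤n , refl
  reduce p 0<p periodic (suc k) with reduce p 0<p periodic k
  ... | d , d<p , d≤k , eq with ℕ.m≤n⇒m<n∨m≡n d<p
  ... | inj₁ 1+d<p = suc d , 1+d<p , s≤s d≤k , cong (σ ⟨$⟩ʳ_) eq
  ... | inj₂ refl = 0 , 0<p , z≤n , trans (sym periodic) (cong (σ ⟨$⟩ʳ_) eq)

  -- All points are reached from `o`, and exponents below `p` suffice, so the points embed into
  -- `Fin p`.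
  period≥n : (p : ℕ) → 0 < p → iter σ p o ≡ o → n ≤ p
  period≥n p 0<p periodic = injective⇒≤ {f = λ x → fromℕ< (proj₁ (proj₂ (exponent x)))} λ {x} {y} eq →
    let d , d<p , _ , σᵈ≡ = exponent x
        e , e<p , _ , σᵉ≡ = exponent y
        d≡e = trans (sym (toℕ-fromℕ< d<p)) (trans (cong toℕ eq) (toℕ-fromℕ< e<p))
    in trans (sym (proj₂ (cyclic o x))) (trans (sym σᵈ≡)
         (trans (cong (λ t → iter σ t o) d≡e) (trans σᵉ≡ (proj₂ (cyclic o y)))))
    where
    exponent : (x : Fin n) → ∃[ d ] (d < p × d ≤ proj₁ (cyclic o x) × iter σ d o ≡ iter σ (proj₁ (cyclic o x)) o)
    exponent x = reduce p 0<p periodic (proj₁ (cyclic o x))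

  repetition : {a b : ℕ} → a < b → iter σ a o ≡ iter σ b o → iter σ (b ∸ a) o ≡ o × n ≤ b ∸ a
  repetition {a} {b} a<b eq = periodic , period≥n (b ∸ a) (ℕ.m<n⇒0<n∸m a<b) periodic
    where
    periodic : iter σ (b ∸ a) o ≡ o
    periodic = sym (iter-injective σ a (trans eq (trans (cong (λ t → iter σ t o) (sym (ℕ.m+[n∸m]≡n (<⇒≤ a<b))))
      (iter-+ σ a (b ∸ a) o))))

  iter-distinct : {a b : ℕ} → a < b → b < n → iter σ a o ≢ iter σ b o
  iter-distinct {a} {b} a<b b<n eq = <⇒≱ b<n (≤-trans (proj₂ (repetition a<b eq)) (ℕ.m∸n≤m b a))

  -- Two of the exponents from 0 to `n` give the same point. Their difference is a period, at most
  -- `n` by its range and at least `n` by `period≥n`.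
  iter-n : iter σ n o ≡ o
  iter-n with pigeonhole {n} {suc n} ≤-refl (λ i → iter σ (toℕ i) o)
  ... | i , j , i<j , eq = let periodic , n≤j∸i = repetition i<j eq in
    subst (λ t → iter σ t o ≡ o)
      (≤-antisym (≤-trans (ℕ.m∸n≤m (toℕ j) (toℕ i)) (ℕ.≤-pred (toℕ<n j))) n≤j∸i) periodic

  iter-+n : (d : ℕ) → iter σ (d + n) o ≡ iter σ d o
  iter-+n d = trans (iter-+ σ d n o) (cong (iter σ d) iter-n)

  reduced : ∀ k → ∃[ d ] (d < n × d ≤ k × iter σ d o ≡ iter σ k o)
  reduced = reduce n (≤-<-trans z≤n (toℕ<n o)) iter-n

  abstract
    distance : Fin n → ℕ
    distance x = proj₁ (reduced (proj₁ (cyclic o x)))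

    distance<n : ∀ x → distance x < n
    distance<n x = proj₁ (proj₂ (reduced (proj₁ (cyclic o x))))

    iter-distance : ∀ x → iter σ (distance x) o ≡ x
    iter-distance x = trans (proj₂ (proj₂ (proj₂ (reduced (proj₁ (cyclic o x)))))) (proj₂ (cyclic o x))

  distance-injective : ∀ {x y} → distance x ≡ distance y → x ≡ y
  distance-injective {x} {y} eq = trans (sym (iter-distance x)) (trans (cong (λ t → iter σ t o) eq) (iter-distance y))

  distance-iter : ∀ {d} → d < n → distance (iter σ d o) ≡ d
  distance-iter {d} d<n with <-cmp (distance (iter σ d o)) d
  ... | tri< lt _ _ = contradiction (iter-distance (iter σ d o)) (iter-distinct lt d<n)
  ... | tri≈ _ eq _ = eq
  ... | tri> _ _ gt = contradiction (sym (iter-distance (iter σ d o))) (iter-distinct gt (distance<n (iter σ d o)))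

  distance-≤ : ∀ {x} k → iter σ k o ≡ x → distance x ≤ k
  distance-≤ k eq = let d , d<n , d≤k , σᵈ≡ = reduced k in
    ≤-trans (≤-reflexive (trans (cong distance (sym (trans σᵈ≡ eq))) (distance-iter d<n))) d≤k

∈-tabulate⁺ : {n : ℕ} (p : Fin n → Bool) {x : Fin n} → p x ≡ true → x ∈ tabulate p
∈-tabulate⁺ p {x} px = lookup⇒[]= x (tabulate p) (trans (lookup∘tabulate p x) px)

∈-tabulate⁻ : {n : ℕ} (p : Fin n → Bool) {x : Fin n} → x ∈ tabulate p → p x ≡ true
∈-tabulate⁻ p {x} x∈ = trans (sym (lookup∘tabulate p x)) ([]=⇒lookup x∈)

record OrderedEnumeration {n : ℕ} (F : Subset n) (position : Fin n → ℕ) : Set where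
  field
    size       : ℕ
    element    : Fin size → Fin n
    increasing : ∀ {a b} → toℕ a < toℕ b → position (element a) < position (element b)
    element∈   : ∀ a → element a ∈ F
    onto       : ∀ x → x ∈ F → ∃[ a ] (element a ≡ x)

  injective : ∀ {a b} → element a ≡ element b → a ≡ b
  injective {a} {b} eq with <-cmp (toℕ a) (toℕ b)
  ... | tri< a<b _ _ = contradiction (increasing a<b) (<-irrefl (cong position eq))
  ... | tri≈ _ a≡b _ = toℕ-injective a≡b
  ... | tri> _ _ b<a = contradiction (increasing b<a) (<-irrefl (cong position (sym eq)))

module _ {n : ℕ} (σ : Permutation′ n) (cyclic : IsCyclic σ) (o : Fin n) where
  open Orbit σ cyclic o

  enumerate : (F : Subset n) → OrderedEnumeration F distance
  enumerate F = record
    { size = northUpTo present n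
    ; element = element
    ; increasing = λ {a} {b} a<b → ≰⇒> λ gb≤ga → <⇒≱ a<b
        (subst₂ _≤_ (count b) (count a) (northUpTo-mono present gb≤ga))
    ; element∈ = λ a → lookup⇒[]= (element a) F (proj₁ (proj₂ (proj₂ (chosen a))))
    ; onto = onto
    }
    where
    -- Read along the orbit, `F` becomes a Boolean sequence, and selecting its true positions lists
    -- `F` by distance.
    present : Fin n → Bool
    present d = lookup F (iter σ (toℕ d) o)

    chosen : (a : Fin (northUpTo present n)) →
      ∃[ d ] (toℕ d < n × present d ≡ true × northUpTo present (toℕ d) ≡ toℕ a)
    chosen a = select present n (toℕ<n a)

    element : Fin (northUpTo present n) → Fin n
    element a = iter σ (toℕ (proj₁ (chosen a))) o

    count : ∀ a → northUpTo present (distance (element a)) ≡ toℕ a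
    count a = let d , d<n , _ , eq = chosen a in trans (cong (northUpTo present) (distance-iter d<n)) eq

    onto : ∀ x → x ∈ F → ∃[ a ] (element a ≡ x)
    onto x x∈F = a , distance-injective (trans (distance-iter (toℕ<n (proj₁ (chosen a)))) (trans (cong toℕ chosen≡d) toℕd))
      where
      d : Fin n
      d = fromℕ< (distance<n x)

      toℕd : toℕ d ≡ distance x
      toℕd = toℕ-fromℕ< (distance<n x)

      present-d : present d ≡ true
      present-d = trans (cong (λ t → lookup F (iter σ t o)) toℕd) (trans (cong (lookup F) (iter-distance x)) ([]=⇒lookup x∈F))

      a : Fin (northUpTo present n)
      a = fromℕ< (northUpTo-< present d present-d (toℕ<n d))

      chosen≡d : proj₁ (chosen a) ≡ d
      chosen≡d = let e , _ , present-e , eq = chosen a in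
        northUpTo-injective present e d present-e present-d (trans eq (toℕ-fromℕ< (northUpTo-< present d present-d (toℕ<n d))))

-- Restriction to a flat

Inside : {n r : ℕ} → (Fin r → Subset n) → Subset n → Fin r → Fin n → Set
Inside A F i x = x ∈ F × x ∈ A i

covers-Inside⇒transversal : {n r : ℕ} (A : Fin r → Subset n) (F X : Subset n) →
  Covers (Inside A F) X → PartialTransversal (memb A) X
covers-Inside⇒transversal A F X (φ , (sound , φ-injective) , covered) =
  covers⇒transversal X (φ , ((λ x i eq → proj₂ (sound x i eq)) , φ-injective) , covered)

transversal-size : {n r : ℕ} (B : Fin r → Fin n → Set) (X : Subset n) → PartialTransversal B X → ∣ X ∣ ≤ r
transversal-size {n} {r} B X independent = let φ , φ-matches , covered = transversal⇒covers {B = B} X independent in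
  ≤-trans (≤-reflexive (∣-∣-northUpTo X))
    (≤-trans
      (≤-trans (northUpTo-⊆ (lookup X) (dom φ) (λ x Xx → dom-complete φ (covered x (lookup⇒[]= x X Xx))))
        (dom-prefix-≤ φ-matches (λ _ → true) n r (λ x i _ _ → toℕ<n i , refl)))
      (northUpTo-≤ {r} (λ _ → true) r))

-- If every index were used, `F` would contain an independent set of size `r`, the largest size
-- possible. Adding the point `e` outside `F` would then not raise the rank, against flatness.
proper-flat-unused-index : {n r : ℕ} (A : Fin r → Subset n) (F : Subset n) → IsProperFlat (PartialTransversal (memb A)) F →
  (φ₀ : Fin n → Maybe (Fin r)) → Matches (Inside A F) φ₀ → ∃[ j ] (¬ Im φ₀ j)
proper-flat-unused-index {n} {r} A F (flat , e , e∉F) φ₀ φ₀-matches with all? (im? φ₀)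
... | no ¬all = ¬∀⟶∃¬ r (Im φ₀) (im? φ₀) ¬all
... | yes all = contradiction
  (rank-r (F ∪ ⁅ e ⁆) (λ x∈Y → p⊆p∪q ⁅ e ⁆ (Y⊆F x∈Y))) (flat e e∉F r (rank-r F Y⊆F))
  where
  Y : Subset n
  Y = tabulate (dom φ₀)

  Y⊆F : Y ⊆ F
  Y⊆F {x} x∈Y = let i , eq = dom-sound φ₀ (∈-tabulate⁻ (dom φ₀) x∈Y) in proj₁ (proj₁ φ₀-matches x i eq)

  Y-independent : PartialTransversal (memb A) Y
  Y-independent = covers-Inside⇒transversal A F Y (φ₀ , φ₀-matches , λ x x∈Y → dom-sound φ₀ (∈-tabulate⁻ (dom φ₀) x∈Y))

  r≤∣Y∣ : r ≤ ∣ Y ∣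
  r≤∣Y∣ = ≤-trans (≤-reflexive (sym (northUpTo-all {r} ≤-refl)))
    (≤-trans (dom-prefix-≥ φ₀ (λ _ → true) n r (λ i _ _ → let x , eq = all i in x , toℕ<n x , eq))
      (≤-trans (northUpTo-⊆ (dom φ₀) (lookup Y) (λ x d → trans (lookup∘tabulate (dom φ₀) x) d))
        (≤-reflexive (sym (∣-∣-northUpTo Y)))))

  rank-r : (X : Subset n) → Y ⊆ X → IsRankOf (PartialTransversal (memb A)) X r
  rank-r X Y⊆X = (Y , Y⊆X , Y-independent , ≤-antisym (transversal-size (memb A) Y Y-independent) r≤∣Y∣) ,
    λ Z _ → transversal-size (memb A) Z

assign-Im : {n r : ℕ} (φ : Fin n → Maybe (Fin r)) (x : Fin n) (i : Fin r) → ¬ Dom φ x →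
  ∀ {j} → Im φ j → Im (assign φ x i) j
assign-Im φ x i x∉Dom {j} (y , φy≡j) =
  y , trans (assign-there φ x i (λ y≡x → x∉Dom (j , trans (cong φ (sym y≡x)) φy≡j))) φy≡j

-- Otherwise a maximal matching could be enlarged by the unused index.
unused-set-covered : {n r : ℕ} {B : Fin r → Fin n → Set} {φ₀ φ : Fin n → Maybe (Fin r)} {j : Fin r} {z : Fin n} →
  ImMaximal B φ₀ → ¬ Im φ₀ j → Matches B φ → (∀ i → Im φ₀ i → Im φ i) → (∀ i → Im φ i → Im φ₀ i) → B j z → Dom φ z
unused-set-covered {φ = φ} {j} {z} maximal j∉Im φ-matches Im⊇ Im⊆ Bjz =
  decidable-stable (any? (λ i → φ z ≟ᴹ just i)) λ z∉Dom → j∉Im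
    (maximal (assign φ z j) (assign-matches φ-matches Bjz (λ j∈Im → j∉Im (Im⊆ j j∈Im)))
      (λ i i∈Im → assign-Im φ z j z∉Dom (Im⊇ i i∈Im)) j (z , assign-here φ z j))

-- Arcs in the linear order that begins with `A j₀`

module CyclicFamily {n r : ℕ} (σ : Permutation′ n) (A : Fin r → Subset n) (cyclic : IsCyclic σ)
  (intervals : ∀ i → IsσInterval σ (A i)) (antichain : IsAntichain A) (j₀ : Fin r) where

  start : Fin r → Fin n
  start j = proj₁ (intervals j)

  len : Fin r → ℕ
  len j = proj₁ (proj₂ (intervals j))

  open Orbit σ cyclic (start j₀) public

  -- `last` is not reduced modulo `n`: an arc that runs on past `start j₀` has `last j` at least
  -- `n`. Membership is therefore stated with exponents rather than distances.
  first last : Fin r → ℕ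
  first j = distance (start j)
  last j = first j + len j

  ∈-intro : ∀ j {x} e → first j ≤ e → e ≤ last j → iter σ e (start j₀) ≡ x → x ∈ A j
  ∈-intro j {x} e first≤e e≤last eq = Equivalence.from (proj₂ (proj₂ (intervals j)) x)
    (e ∸ first j , ℕ.m≤n+o⇒m∸n≤o e (first j) e≤last , trans (cong (iter σ (e ∸ first j)) (sym (iter-distance (start j))))
      (trans (sym (iter-+ σ (e ∸ first j) (first j) (start j₀)))
        (trans (cong (λ t → iter σ t (start j₀)) (ℕ.m∸n+n≡m first≤e)) eq)))

  ∈-elim : ∀ j {x} → x ∈ A j → ∃[ e ] (first j ≤ e × e ≤ last j × iter σ e (start j₀) ≡ x)
  ∈-elim j {x} x∈A = let d , d≤len , eq = Equivalence.to (proj₂ (proj₂ (intervals j)) x) x∈A in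
    first j + d , ℕ.m≤m+n (first j) d , ℕ.+-monoʳ-≤ (first j) d≤len ,
    trans (cong (λ t → iter σ t (start j₀)) (ℕ.+-comm (first j) d))
      (trans (iter-+ σ d (first j) (start j₀)) (trans (cong (iter σ d) (iter-distance (start j))) eq))

  ∈-first : ∀ {d x} → d ≤ len j₀ → iter σ d (start j₀) ≡ x → x ∈ A j₀
  ∈-first {d} {x} d≤len eq = Equivalence.from (proj₂ (proj₂ (intervals j₀)) x) (d , d≤len , eq)

  ⊆-between : ∀ i j → first j ≤ first i → last i ≤ last j → A i ⊆ A j
  ⊆-between i j first≤ last≤ x∈A = let e , first≤e , e≤last , eq = ∈-elim i x∈A in
    ∈-intro j e (≤-trans first≤ first≤e) (≤-trans e≤last last≤) eq

  -- Arcs with the same start are nested, which the antichain condition excludes.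
  first-injective : ∀ {i j} → first i ≡ first j → i ≡ j
  first-injective {i} {j} eq = decidable-stable (i Fin.≟ j) λ i≢j → incomparable i≢j (ℕ.≤-total (last i) (last j))
    where
    incomparable : i ≢ j → ¬ (last i ≤ last j ⊎ last j ≤ last i)
    incomparable i≢j (inj₁ le) = antichain i j i≢j (⊆-between i j (≤-reflexive (sym eq)) le)
    incomparable i≢j (inj₂ ge) = antichain j i (i≢j ∘ sym) (⊆-between j i (≤-reflexive eq) ge)

  -- Otherwise the arc `A j` would lie inside `A i`.
  last-mono : ∀ {i j} → first i < first j → last i ≤ last j
  last-mono {i} {j} lt = ≮⇒≥ λ last< → antichain j i (λ j≡i → <-irrefl (cong first (sym j≡i)) lt)
    (⊆-between j i (<⇒≤ lt) (<⇒≤ last<))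

  -- An arc A j passing start j₀ and reaching a point outside A j₀ beyond it would contain A j₀.
  outside-interval : ∀ j {x} → x ∈ A j → x ∉ A j₀ → first j ≤ distance x × distance x ≤ last j
  outside-interval j {x} x∈A x∉A₀ with ∈-elim j x∈A
  ... | e , first≤e , e≤last , eq with e <? n
  ... | yes e<n = let distance≡e = trans (cong distance (sym eq)) (distance-iter e<n) in
    ≤-trans first≤e (≤-reflexive (sym distance≡e)) , ≤-trans (≤-reflexive distance≡e) e≤last
  ... | no e≮n = ⊥-elim (antichain j₀ j (λ j₀≡j → x∉A₀ (subst (λ i → x ∈ A i) (sym j₀≡j) x∈A)) A₀⊆A)
    where
    t : ℕ
    t = e ∸ n

    t+n≡e : t + n ≡ e
    t+n≡e = ℕ.m∸n+n≡m (≮⇒≥ e≮n)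

    len<t : len j₀ < t
    len<t = ≰⇒> λ t≤len → x∉A₀ (∈-first t≤len
      (trans (sym (iter-+n t)) (trans (cong (λ s → iter σ s (start j₀)) t+n≡e) eq)))

    -- A point of `A j₀` at exponent `d` recurs at `d + n`, which lies between `first j`, itself
    -- below `n`, and `e`, which equals `t + n`.
    A₀⊆A : A j₀ ⊆ A j
    A₀⊆A {y} y∈A₀ = let d , d≤len , eq′ = Equivalence.to (proj₂ (proj₂ (intervals j₀)) y) y∈A₀ in
      ∈-intro j (d + n) (≤-trans (<⇒≤ (distance<n (start j))) (ℕ.m≤n+m n d))
        (≤-trans (ℕ.+-monoˡ-≤ n (≤-trans d≤len (<⇒≤ len<t))) (≤-trans (≤-reflexive t+n≡e) e≤last))
        (trans (iter-+n d) eq′)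

  ∈-between : ∀ j {x} → first j ≤ distance x → distance x ≤ last j → x ∈ A j
  ∈-between j {x} first≤ ≤last = ∈-intro j (distance x) first≤ ≤last (iter-distance x)

  -- Distances are measured from `start j₀`, so `A j₀` is an initial segment of the order.
  inside-before-outside : ∀ {x y} → x ∈ A j₀ → y ∉ A j₀ → distance x < distance y
  inside-before-outside {x} {y} x∈A₀ y∉A₀ =
    let d , d≤len , eq = Equivalence.to (proj₂ (proj₂ (intervals j₀)) x) x∈A₀ in
    ≰⇒> λ dy≤dx → y∉A₀ (∈-first (≤-trans dy≤dx (≤-trans (distance-≤ d eq) d≤len)) (iter-distance y))

  -- A monotone presentation of the restriction

  module Restriction (F : Subset n) (enumeration : OrderedEnumeration F distance)
    (φ₀ : Fin n → Maybe (Fin r)) (φ₀-matches : Matches (Inside A F) φ₀) (φ₀-maximal : ImMaximal (Inside A F) φ₀)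
    (j₀∉Im : ¬ Im φ₀ j₀) where

    open OrderedEnumeration enumeration

    -- A coloop z ∈ A j₀ gets the singleton {z}, indexed by its position; every A j gets its trace outside A j₀,
    -- indexed (after the singletons) by the position of its first element.
    D : Fin (n + n) → Fin size → Set
    D i a = (element a ∈ A j₀ × distance (element a) ≡ toℕ i) ⊎
            (element a ∉ A j₀ × ∃[ j ] (element a ∈ A j × n + first j ≡ toℕ i))

    D? : ∀ i a → Dec (D i a)
    D? i a = (element a ∈? A j₀ ×-dec distance (element a) ℕ.≟ toℕ i) ⊎-dec
      (¬? (element a ∈? A j₀) ×-dec any? (λ j → element a ∈? A j ×-dec n + first j ℕ.≟ toℕ i))

    -- Singletons precede traces in index, being below `n`, and in position, since `A j₀` is an
    -- initial segment. Among singletons the index is the position; among traces the antichain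
    -- condition makes the ends increase with the starts.
    D-monotone : IsMonotoneFamily D
    D-monotone = record { convex = convex ; uncross = uncross }
      where
      convex : ∀ i {x y z} → toℕ x < toℕ y → toℕ y < toℕ z → D i x → D i z → D i y
      convex i x<y y<z (inj₁ (_ , dx≡i)) (inj₁ (_ , dz≡i)) =
        contradiction (<-trans (increasing x<y) (increasing y<z)) (<-irrefl (trans dx≡i (sym dz≡i)))
      convex i {x} {z = z} x<y y<z (inj₁ (_ , dx≡i)) (inj₂ (_ , j , _ , fj≡i)) =
        contradiction (ℕ.m≤m+n n (first j)) (<⇒≱ (subst (_< n) (trans dx≡i (sym fj≡i)) (distance<n (element x))))
      convex i x<y y<z (inj₂ (x∉A₀ , _)) (inj₁ (z∈A₀ , _)) =
        contradiction (inside-before-outside z∈A₀ x∉A₀) (ℕ.<-asym (<-trans (increasing x<y) (increasing y<z)))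
      convex i x<y y<z (inj₂ (x∉A₀ , j , x∈A , fj≡i)) (inj₂ (z∉A₀ , j′ , z∈A′ , fj′≡i)) =
        inj₂ ((λ y∈A₀ → ℕ.<-asym (increasing x<y) (inside-before-outside y∈A₀ x∉A₀)) , j ,
          ∈-between j (≤-trans (proj₁ (outside-interval j x∈A x∉A₀)) (<⇒≤ (increasing x<y)))
            (≤-trans (<⇒≤ (increasing y<z)) (proj₂ (outside-interval j z∈A z∉A₀))) , fj≡i)
        where
        z∈A : _ ∈ A j
        z∈A = subst (λ l → _ ∈ A l) (first-injective (ℕ.+-cancelˡ-≡ n _ _ (trans fj′≡i (sym fj≡i)))) z∈A′

      uncross : ∀ {i i′ x y} → toℕ i < toℕ i′ → toℕ x < toℕ y → D i y → D i′ x → D i x × D i′ y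
      uncross i<i′ x<y (inj₁ (_ , dy≡i)) (inj₁ (_ , dx≡i′)) =
        contradiction (subst₂ _<_ (sym dy≡i) (sym dx≡i′) i<i′) (ℕ.<-asym (increasing x<y))
      uncross i<i′ x<y (inj₁ (y∈A₀ , _)) (inj₂ (x∉A₀ , _)) =
        contradiction (inside-before-outside y∈A₀ x∉A₀) (ℕ.<-asym (increasing x<y))
      uncross {x = x} i<i′ x<y (inj₂ (_ , j , _ , fj≡i)) (inj₁ (_ , dx≡i′)) =
        contradiction (ℕ.m≤m+n n (first j))
          (<⇒≱ (<-trans (subst₂ _<_ (sym fj≡i) (sym dx≡i′) i<i′) (distance<n (element x))))
      uncross i<i′ x<y (inj₂ (y∉A₀ , j , y∈A , fj≡i)) (inj₂ (x∉A₀ , j′ , x∈A′ , fj′≡i′)) =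
        inj₂ (x∉A₀ , j , ∈-between j
          (≤-trans (<⇒≤ first<) (proj₁ (outside-interval j′ x∈A′ x∉A₀)))
          (≤-trans (<⇒≤ (increasing x<y)) (proj₂ (outside-interval j y∈A y∉A₀))) , fj≡i) ,
        inj₂ (y∉A₀ , j′ , ∈-between j′
          (≤-trans (proj₁ (outside-interval j′ x∈A′ x∉A₀)) (<⇒≤ (increasing x<y)))
          (≤-trans (proj₂ (outside-interval j y∈A y∉A₀)) (last-mono first<)) , fj′≡i′)
        where
        first< : first j < first j′
        first< = ℕ.+-cancelˡ-< n _ _ (subst₂ _<_ (sym fj≡i) (sym fj′≡i′) i<i′)

    pullback : Subset n → Subset size
    pullback X = tabulate (λ a → lookup X (element a))

    ∈-pullback⁺ : ∀ X {a} → element a ∈ X → a ∈ pullback X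
    ∈-pullback⁺ X a∈ = ∈-tabulate⁺ (λ a → lookup X (element a)) ([]=⇒lookup a∈)

    ∈-pullback⁻ : ∀ X {a} → a ∈ pullback X → element a ∈ X
    ∈-pullback⁻ X {a} a∈ = lookup⇒[]= (element a) X (∈-tabulate⁻ (λ a → lookup X (element a)) a∈)

    -- Elements in `A j₀` move to their own singletons, and all others keep the set that `ψ` assigns
    -- to them, now as a trace.
    independent⇒D : (X : Subset n) → PartialTransversal (memb A) X → PartialTransversal D (pullback X)
    independent⇒D X (ψ , ψ∈A , ψ-injective) =
      (λ a a∈Y → proj₁ (index a a∈Y)) ,
      (λ a a∈Y → belongs a a∈Y (proj₂ (index a a∈Y))) ,
      λ a b a∈Y b∈Y eq → unique a b a∈Y b∈Y (proj₂ (index a a∈Y)) (subst (Index b b∈Y) (sym eq) (proj₂ (index b b∈Y)))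
      where
      -- The second case keeps hold of the set chosen by `ψ`, whose injectivity is needed in
      -- `unique`.
      Index : ∀ a → a ∈ pullback X → Fin (n + n) → Set
      Index a a∈Y i = (element a ∈ A j₀ × distance (element a) ≡ toℕ i) ⊎
        (element a ∉ A j₀ × n + first (ψ (element a) (∈-pullback⁻ X a∈Y)) ≡ toℕ i)

      index : ∀ a a∈Y → ∃[ i ] (Index a a∈Y i)
      index a a∈Y with element a ∈? A j₀
      ... | yes a∈A₀ = fromℕ< d<n+n , inj₁ (a∈A₀ , sym (toℕ-fromℕ< d<n+n))
        where
        d<n+n : distance (element a) < n + n
        d<n+n = <-≤-trans (distance<n (element a)) (ℕ.m≤m+n n n)
      ... | no a∉A₀ = fromℕ< f<n+n , inj₂ (a∉A₀ , sym (toℕ-fromℕ< f<n+n))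
        where
        f<n+n : n + first (ψ (element a) (∈-pullback⁻ X a∈Y)) < n + n
        f<n+n = ℕ.+-monoʳ-< n (distance<n (start (ψ (element a) (∈-pullback⁻ X a∈Y))))

      belongs : ∀ a a∈Y {i} → Index a a∈Y i → D i a
      belongs a a∈Y (inj₁ coloop) = inj₁ coloop
      belongs a a∈Y (inj₂ (a∉A₀ , eq)) = inj₂ (a∉A₀ , _ , ψ∈A (element a) (∈-pullback⁻ X a∈Y) , eq)

      unique : ∀ a b a∈Y b∈Y {i} → Index a a∈Y i → Index b b∈Y i → a ≡ b
      unique a b _ _ (inj₁ (_ , da≡i)) (inj₁ (_ , db≡i)) = injective (distance-injective (trans da≡i (sym db≡i)))
      unique a b _ _ (inj₁ (a∈A₀ , da≡i)) (inj₂ (_ , fb≡i)) =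
        contradiction (ℕ.m≤m+n n _) (<⇒≱ (subst (_< n) (trans da≡i (sym fb≡i)) (distance<n (element a))))
      unique a b _ _ (inj₂ (_ , fa≡i)) (inj₁ (b∈A₀ , db≡i)) =
        contradiction (ℕ.m≤m+n n _) (<⇒≱ (subst (_< n) (trans db≡i (sym fa≡i)) (distance<n (element b))))
      unique a b a∈Y b∈Y (inj₂ (_ , fa≡i)) (inj₂ (_ , fb≡i)) = injective
        (ψ-injective _ _ (∈-pullback⁻ X a∈Y) (∈-pullback⁻ X b∈Y)
          (first-injective (ℕ.+-cancelˡ-≡ n _ _ (trans fa≡i (sym fb≡i)))))

    -- Only the part of `X` outside `A j₀` is matched through the traces. Once extended to use
    -- exactly the indices of `φ₀`, the matching covers all of `F` inside `A j₀` by itself, since an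
    -- uncovered point there could take the free index `j₀`.
    D⇒independent : (X : Subset n) → X ⊆ F → PartialTransversal D (pullback X) → PartialTransversal (memb A) X
    D⇒independent X X⊆F (θ , θ∈D , θ-injective) =
      let φ , φ-matches , covered = transversal⇒covers X∖A₀ (ψ , ψ-sound , ψ-injective)
          φ′ , φ′-matches , grows , Im⊇ , Im⊆ = extend-to φ₀-matches φ₀-maximal φ φ-matches
      in covers-Inside⇒transversal A F X (φ′ , φ′-matches , λ x x∈X → cover φ′ φ′-matches Im⊇ Im⊆
           (λ x∉A₀ → grows x (covered x (∈-tabulate⁺ _ (dec-true (remaining? x) (x∈X , x∉A₀))))) x∈X (x ∈? A j₀))
      where
      remaining? : ∀ x → Dec (x ∈ X × x ∉ A j₀)
      remaining? x = x ∈? X ×-dec ¬? (x ∈? A j₀)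

      X∖A₀ : Subset n
      X∖A₀ = tabulate (λ x → does (remaining? x))

      place : ∀ x → x ∈ X∖A₀ →
        ∃[ a ] (element a ≡ x × Σ (a ∈ pullback X) λ a∈Y → ∃[ j ] (x ∈ A j × n + first j ≡ toℕ (θ a a∈Y)))
      place x x∈ = let x∈X , x∉A₀ = does-sound (remaining? x) (∈-tabulate⁻ _ x∈)
                       a , a≡x = onto x (X⊆F x∈X)
                       a∈Y = ∈-pullback⁺ X (subst (_∈ X) (sym a≡x) x∈X)
                   in a , a≡x , a∈Y , arc a≡x x∉A₀ (θ∈D a a∈Y)
        where
        arc : ∀ {a i} → element a ≡ x → x ∉ A j₀ → D i a → ∃[ j ] (x ∈ A j × n + first j ≡ toℕ i)
        arc refl x∉A₀ (inj₁ (x∈A₀ , _)) = contradiction x∈A₀ x∉A₀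
        arc refl x∉A₀ (inj₂ (_ , found)) = found

      ψ : ∀ x → x ∈ X∖A₀ → Fin r
      ψ x x∈ = proj₁ (proj₂ (proj₂ (proj₂ (place x x∈))))

      ψ-sound : ∀ x x∈ → Inside A F (ψ x x∈) x
      ψ-sound x x∈ = X⊆F (proj₁ (does-sound (remaining? x) (∈-tabulate⁻ _ x∈))) ,
        proj₁ (proj₂ (proj₂ (proj₂ (proj₂ (place x x∈)))))

      ψ-injective : ∀ x y x∈ y∈ → ψ x x∈ ≡ ψ y y∈ → x ≡ y
      ψ-injective x y x∈ y∈ eq =
        let a , a≡x , a∈Y , j , _ , fj≡ = place x x∈
            b , b≡y , b∈Y , j′ , _ , fj′≡ = place y y∈
            a≡b = θ-injective a b a∈Y b∈Y (toℕ-injective (trans (sym fj≡) (trans (cong (λ l → n + first l) eq) fj′≡)))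
        in trans (sym a≡x) (trans (cong element a≡b) b≡y)

      cover : ∀ φ → Matches (Inside A F) φ → (∀ i → Im φ₀ i → Im φ i) → (∀ i → Im φ i → Im φ₀ i) →
        ∀ {x} → (x ∉ A j₀ → Dom φ x) → x ∈ X → Dec (x ∈ A j₀) → Dom φ x
      cover φ φ-matches Im⊇ Im⊆ outside x∈X (yes x∈A₀) =
        unused-set-covered φ₀-maximal j₀∉Im φ-matches Im⊇ Im⊆ (X⊆F x∈X , x∈A₀)
      cover φ φ-matches Im⊇ Im⊆ outside x∈X (no x∉A₀) = outside x∉A₀

restriction-isLPM : {n N : ℕ} {I : Indep n} {F : Subset n} {J : Indep N} (g : Fin N → Fin n) →
  (∀ {a b} → g a ≡ g b → a ≡ b) → (∀ a → g a ∈ F) → (∀ x → x ∈ F → ∃[ a ] (g a ≡ x)) →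
  (∀ X → X ⊆ F → I X ⇔ J (tabulate (λ a → lookup X (g a)))) → IsLPM N J → RestrictionIsLPM I F
restriction-isLPM {F = F} g g-injective g∈F g-onto I⇔J (lpm {m} {r} P Q P-path Q-path P≤Q J⇔LPM) =
  m , r , P , Q , P-path , Q-path , P≤Q , g , (λ a b → g-injective) ,
  (λ x → mk⇔ (g-onto x) (λ (a , eq) → subst (_∈ F) eq (g∈F a))) ,
  λ X X⊆F → mk⇔
    (λ independent → Equivalence.to (J⇔LPM _) (Equivalence.to (I⇔J X X⊆F) independent))
    (λ independent → Equivalence.from (I⇔J X X⊆F) (Equivalence.from (J⇔LPM _) independent))

theorem6p3 : (n r : ℕ) (σ : Permutation′ n) (A : Fin r → Subset n) →
    IsCyclic σ → (∀ i → IsσInterval σ (A i)) → IsAntichain A →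
    (F : Subset n) → IsProperFlat (PartialTransversal (memb A)) F →
    RestrictionIsLPM (PartialTransversal (memb A)) F
theorem6p3 n r σ A cyclic intervals antichain F proper-flat =
  let φ₀ , φ₀-matches , φ₀-maximal = maximal-matching (λ i x → x ∈? F ×-dec x ∈? A i)
      j₀ , j₀∉Im = proper-flat-unused-index A F proper-flat φ₀ φ₀-matches
      enumeration = enumerate σ cyclic (proj₁ (intervals j₀)) F
      open OrderedEnumeration enumeration
      open CyclicFamily.Restriction σ A cyclic intervals antichain j₀ F enumeration φ₀ φ₀-matches φ₀-maximal j₀∉Im
  in restriction-isLPM element injective element∈ onto
       (λ X X⊆F → mk⇔ (independent⇒D X) (D⇒independent X X⊆F))
       (monotone-family-isLPM D D? D-monotone)
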